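{- Any multiverse $\mathcal M$ satisfying the Wellfoundedness Mirage axiom consists entirely of computably saturated models of $\mathrm{ZFC}$.
   Context: A \emph{multiverse} is a nonempty set or class of models of $\mathrm{ZFC}$. A multiverse $\mathcal M$ satisfies the \emph{Wellfoundedness Mirage} axiom if for every $M\in\mathcal M$ there is $N\in\mathcal M$ which thinks $M$ is a set with an ill-founded $\omega$. When it is said that a model $M$ is an element of (or a set in) another model $N$, what is meant is that there is an object in $N$ that $N$ thinks is a pair $\langle m,E\rangle$ with $E$ a binary relation on $m$, and externally the set $\{a\in N\mid N\models a\in m\}$ with the relation $\{(a,b)\mid N\models a\mathrel{E}b\}$ is isomorphic to $M$ with its membership relation. It is not required that $N$ regard $M$ as a model of $\mathrm{ZFC}$. A model $M$ of a computable language is \emph{computably saturated} if for every finite tuple $\bar a$ in $M$, every finitely realizable computable type $p(\bar a,\bar x)$ is already realized in $M$; a type $p(\bar y,\bar x)$ is computable if the set of Gödel codes of its formulas is computable. -}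

module Defs where

open import Data.Empty.Polymorphic using (⊥)
open import Data.Fin.Base using (Fin; zero; suc; toℕ; lift; _↑ʳ_)
open import Data.List.Base using (List)
open import Data.List.Relation.Unary.All using (All)
open import Data.Nat.Base using (ℕ; zero; suc; _+_; _*_; _^_; _<_)
open import Data.Product.Base using (_×_; ∃; ∃-syntax; Σ-syntax)
open import Data.Sum.Base using (_⊎_)
open import Data.Vec.Base using (Vec; []; _∷_; _++_; lookup)
open import Data.Vec.Functional using () renaming (_∷_ to _◂_)
open import Function.Bundles using (_⇔_)
open import Function.Definitions using (Injective)
open import Level using (Level; 0ℓ; _⊔_) renaming (suc to lsuc)
open import Relation.Binary.Core using (Rel)
open import Relation.Binary.PropositionalEquality.Core using (_≡_)
open import Relation.Nullary.Negation.Core using (¬_)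
open import Relation.Unary using (Pred)

private
  variable
    ℓ ℓ′ : Level
    n k : ℕ

infixr 10 ¬′_ ∀′_ ∃′_
infix  9 _∈′_ _≐_ _⊆′_
infixr 7 _∧′_
infixr 6 _∨′_
infixr 5 _⇒′_
infix  4 _⇔′_

-- De Bruijn indices: the free variables of φ : Formula n are Fin n, and
-- a quantifier binds variable zero of its body.
data Formula : ℕ → Set where
  _∈′_ _≐_       : (x y : Fin n) → Formula n
  ⊥′             : Formula n
  _⇒′_ _∧′_ _∨′_ : (φ ψ : Formula n) → Formula n
  ∀′_ ∃′_        : (φ : Formula (suc n)) → Formula n

Sentence : Set
Sentence = Formula 0

¬′_ : Formula n → Formula n
¬′ φ = φ ⇒′ ⊥′

_⇔′_ : (φ ψ : Formula n) → Formula n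
φ ⇔′ ψ = (φ ⇒′ ψ) ∧′ (ψ ⇒′ φ)

rename : (Fin n → Fin k) → Formula n → Formula k
rename ρ (x ∈′ y) = ρ x ∈′ ρ y
rename ρ (x ≐ y)  = ρ x ≐ ρ y
rename ρ ⊥′       = ⊥′
rename ρ (φ ⇒′ ψ) = rename ρ φ ⇒′ rename ρ ψ
rename ρ (φ ∧′ ψ) = rename ρ φ ∧′ rename ρ ψ
rename ρ (φ ∨′ ψ) = rename ρ φ ∨′ rename ρ ψ
rename ρ (∀′ φ)   = ∀′ rename (lift 1 ρ) φ
rename ρ (∃′ φ)   = ∃′ rename (lift 1 ρ) φ

closure : Formula n → Sentence
closure {zero}  φ = φ
closure {suc n} φ = closure (∀′ φ)

record Structure ℓ : Set (lsuc ℓ) where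
  infix 4 _∈_
  field
    Carrier : Set ℓ
    _∈_     : Rel Carrier ℓ

infix 3 _⊨_[_]

_⊨_[_] : (M : Structure ℓ) → Formula n → Vec (Structure.Carrier M) n → Set ℓ
M ⊨ x ∈′ y [ e ] = Structure._∈_ M (lookup e x) (lookup e y)
M ⊨ x ≐ y  [ e ] = lookup e x ≡ lookup e y
M ⊨ ⊥′     [ e ] = ⊥
M ⊨ φ ⇒′ ψ [ e ] = M ⊨ φ [ e ] → M ⊨ ψ [ e ]
M ⊨ φ ∧′ ψ [ e ] = M ⊨ φ [ e ] × M ⊨ ψ [ e ]
M ⊨ φ ∨′ ψ [ e ] = M ⊨ φ [ e ] ⊎ M ⊨ ψ [ e ]
M ⊨ ∀′ φ   [ e ] = ∀ a → M ⊨ φ [ a ∷ e ]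
M ⊨ ∃′ φ   [ e ] = ∃[ a ] M ⊨ φ [ a ∷ e ]

pattern #0 = zero
pattern #1 = suc #0
pattern #2 = suc #1
pattern #3 = suc #2

_⊆′_ : (x y : Fin n) → Formula n
x ⊆′ y = ∀′ (#0 ∈′ suc x ⇒′ #0 ∈′ suc y)

nonempty : Fin n → Formula n
nonempty x = ∃′ (#0 ∈′ suc x)

empty : Fin n → Formula n
empty x = ∀′ (¬′ (#0 ∈′ suc x))

-- y = x ∪ {x}
successor : (y x : Fin n) → Formula n
successor y x = ∀′ (#0 ∈′ suc y ⇔′ #0 ∈′ suc x ∨′ #0 ≐ suc x)

inductive′ : Fin n → Formula n
inductive′ w =
    ∃′ (empty #0 ∧′ #0 ∈′ suc w)
  ∧′ ∀′ (#0 ∈′ suc w ⇒′ ∃′ (successor #0 #1 ∧′ #0 ∈′ suc (suc w)))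

-- w = ω, the least inductive set
omega : Fin n → Formula n
omega w = inductive′ w ∧′ ∀′ (inductive′ #0 ⇒′ suc w ⊆′ #0)

-- z = {x , y}
unorderedPair : (z x y : Fin n) → Formula n
unorderedPair z x y = ∀′ (#0 ∈′ suc z ⇔′ #0 ≐ suc x ∨′ #0 ≐ suc y)

-- z = ⟨x , y⟩ = {{x} , {x , y}}
orderedPair : (z x y : Fin n) → Formula n
orderedPair z x y = ∃′ ∃′
  (  unorderedPair #1 (suc (suc x)) (suc (suc x))
  ∧′ unorderedPair #0 (suc (suc x)) (suc (suc y))
  ∧′ unorderedPair (suc (suc z)) #1 #0 )

-- ⟨x , y⟩ ∈ E
related : (x E y : Fin n) → Formula n
related x E y = ∃′ (orderedPair #0 (suc x) (suc y) ∧′ #0 ∈′ suc E)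

-- E ⊆ m × m
binaryRelationOn : (E m : Fin n) → Formula n
binaryRelationOn E m = ∀′ (#0 ∈′ suc E ⇒′
  ∃′ ∃′ (#1 ∈′ (3 ↑ʳ m) ∧′ #0 ∈′ (3 ↑ʳ m) ∧′ orderedPair #2 #1 #0))

extensionality foundation pairing union powerSet infinity choice : Sentence

extensionality = ∀′ ∀′ (∀′ (#0 ∈′ #2 ⇔′ #0 ∈′ #1) ⇒′ #1 ≐ #0)

foundation = ∀′ (nonempty #0 ⇒′
  ∃′ (#0 ∈′ #1 ∧′ ∀′ (#0 ∈′ #1 ⇒′ ¬′ (#0 ∈′ #2))))

pairing = ∀′ ∀′ ∃′ unorderedPair #0 #2 #1

union = ∀′ ∃′ ∀′ (#0 ∈′ #1 ⇔′ ∃′ (#0 ∈′ #3 ∧′ #1 ∈′ #0))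

powerSet = ∀′ ∃′ ∀′ (#0 ∈′ #1 ⇔′ #0 ⊆′ #2)

infinity = ∃′ inductive′ #0

-- Every family of nonempty, pairwise disjoint sets has a transversal.
choice = ∀′
  (  ∀′ (#0 ∈′ #1 ⇒′ nonempty #0)
  ∧′ ∀′ ∀′ (#1 ∈′ #2 ∧′ #0 ∈′ #2 ∧′ ∃′ (#0 ∈′ #2 ∧′ #0 ∈′ #1) ⇒′ #1 ≐ #0)
  ⇒′ ∃′ ∀′ (#0 ∈′ #2 ⇒′
       ∃′ (#0 ∈′ #1 ∧′ #0 ∈′ #2 ∧′ ∀′ (#0 ∈′ #2 ∧′ #0 ∈′ #3 ⇒′ #0 ≐ #1))))

-- ∀p̄ ∀a ∃b ∀x (x ∈ b ⇔ x ∈ a ∧ φ(x , p̄))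
separation : Formula (suc n) → Sentence
separation φ = closure
  (∀′ ∃′ ∀′ (#0 ∈′ #1 ⇔′ #0 ∈′ #2 ∧′ rename (lift 1 (2 ↑ʳ_)) φ))

-- ∀p̄ ∀a ((∀x ∈ a) ∀y ∀z (φ(x , y , p̄) ∧ φ(x , z , p̄) ⇒ y = z)
--          ⇒ ∃b ∀y (y ∈ b ⇔ (∃x ∈ a) φ(x , y , p̄)))
replacement : Formula (suc (suc n)) → Sentence
replacement φ = closure
  (∀′ (  ∀′ (#0 ∈′ #1 ⇒′ ∀′ ∀′
           (  rename (#2 ◂ #1 ◂ (4 ↑ʳ_)) φ
           ∧′ rename (#2 ◂ #0 ◂ (4 ↑ʳ_)) φ
           ⇒′ #1 ≐ #0))
      ⇒′ ∃′ ∀′ (#0 ∈′ #1 ⇔′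
           ∃′ (#0 ∈′ #3 ∧′ rename (lift 2 (2 ↑ʳ_)) φ))))

data ZFC : Sentence → Set where
  extensionality′ : ZFC extensionality
  foundation′     : ZFC foundation
  pairing′        : ZFC pairing
  union′          : ZFC union
  powerSet′       : ZFC powerSet
  infinity′       : ZFC infinity
  choice′         : ZFC choice
  separation′     : (φ : Formula (suc n)) → ZFC (separation φ)
  replacement′    : (φ : Formula (suc (suc n))) → ZFC (replacement φ)

_⊨ZFC : Structure ℓ → Set ℓ
M ⊨ZFC = ∀ {σ} → ZFC σ → M ⊨ σ [ [] ]

record Multiverse ℓ ℓ′ : Set (lsuc (ℓ ⊔ ℓ′)) where
  field
    Member    : Pred (Structure ℓ) ℓ′
    inhabited : ∃ Member
    models    : ∀ {M} → Member M → M ⊨ZFC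

-- φ ^⟨ m , E ⟩ says that φ holds in the structure ⟨m , E⟩; here m and E
-- are variables, and the free variables of φ stand for elements of m.
_^⟨_,_⟩ : Formula n → (m E : Fin n) → Formula n
(x ∈′ y) ^⟨ m , E ⟩ = related x E y
(x ≐ y)  ^⟨ m , E ⟩ = x ≐ y
⊥′       ^⟨ m , E ⟩ = ⊥′
(φ ⇒′ ψ) ^⟨ m , E ⟩ = φ ^⟨ m , E ⟩ ⇒′ ψ ^⟨ m , E ⟩
(φ ∧′ ψ) ^⟨ m , E ⟩ = φ ^⟨ m , E ⟩ ∧′ ψ ^⟨ m , E ⟩
(φ ∨′ ψ) ^⟨ m , E ⟩ = φ ^⟨ m , E ⟩ ∨′ ψ ^⟨ m , E ⟩
(∀′ φ)   ^⟨ m , E ⟩ = ∀′ (#0 ∈′ suc m ⇒′ φ ^⟨ suc m , suc E ⟩)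
(∃′ φ)   ^⟨ m , E ⟩ = ∃′ (#0 ∈′ suc m ∧′ φ ^⟨ suc m , suc E ⟩)

-- For some w that is the ω of ⟨m , E⟩, there is a nonempty set s of
-- E-predecessors of w with no E-minimal element.
illFoundedOmega : (m E : Fin n) → Formula n
illFoundedOmega m E = ∃′
  (  #0 ∈′ suc m
  ∧′ omega #0 ^⟨ suc m , suc E ⟩
  ∧′ ∃′ (  nonempty #0
        ∧′ ∀′ (#0 ∈′ #1 ⇒′ #0 ∈′ (3 ↑ʳ m) ∧′ related #0 (3 ↑ʳ E) #2)
        ∧′ ∀′ (#0 ∈′ #1 ⇒′ ∃′ (#0 ∈′ #2 ∧′ related #0 (4 ↑ʳ E) #1)) ) )

-- M is, up to isomorphism, the extension of the object ⟨m , E⟩ of N.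
-- The isomorphism is given as an injection into N with range m, since
-- the type of pairs (a , a ∈ m) may have several proofs for each a.
record IsSetIn (M N : Structure ℓ) (m E : Structure.Carrier N) : Set ℓ where
  private
    module M = Structure M
    module N = Structure N
  field
    pair      : N.Carrier
    isPair    : N ⊨ orderedPair #0 #1 #2 [ pair ∷ m ∷ E ∷ [] ]
    relation  : N ⊨ binaryRelationOn #1 #0 [ m ∷ E ∷ [] ]
    embed     : M.Carrier → N.Carrier
    injective : Injective _≡_ _≡_ embed
    range     : ∀ a → (a N.∈ m) ⇔ (∃[ x ] embed x ≡ a)
    preserves : ∀ x y → (x M.∈ y) ⇔
                  (N ⊨ related #0 #2 #1 [ embed x ∷ embed y ∷ E ∷ [] ])

ThinksHasIllFoundedOmega : (N M : Structure ℓ) → Set ℓ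
ThinksHasIllFoundedOmega N M =
  ∃[ m ] ∃[ E ] IsSetIn M N m E × (N ⊨ illFoundedOmega #0 #1 [ m ∷ E ∷ [] ])

WellfoundednessMirage : Multiverse ℓ ℓ′ → Set (lsuc ℓ ⊔ ℓ′)
WellfoundednessMirage 𝓜 =
  ∀ M → Member M → ∃[ N ] Member N × ThinksHasIllFoundedOmega N M
  where open Multiverse 𝓜

-- μ-recursive functions; f [ xs ]⇓ v means that f is defined at xs with
-- value v.
data Rec : ℕ → Set where
  zer  : Rec n
  succ : Rec 1
  proj : Fin n → Rec n
  comp : Rec k → Vec (Rec n) k → Rec n
  prec : Rec n → Rec (suc (suc n)) → Rec (suc n)
  mu   : Rec (suc n) → Rec n

infix 4 _[_]⇓_

data _[_]⇓_ : Rec n → Vec ℕ n → ℕ → Set where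
  zer⇓   : {xs : Vec ℕ n} → zer [ xs ]⇓ 0
  succ⇓  : ∀ {x} → succ [ x ∷ [] ]⇓ suc x
  proj⇓  : ∀ {i} {xs : Vec ℕ n} → proj i [ xs ]⇓ lookup xs i
  comp⇓  : ∀ {f : Rec k} {gs : Vec (Rec n) k} {xs ys v} →
           (∀ i → lookup gs i [ xs ]⇓ lookup ys i) →
           f [ ys ]⇓ v → comp f gs [ xs ]⇓ v
  precZ⇓ : ∀ {f : Rec n} {g xs v} →
           f [ xs ]⇓ v → prec f g [ 0 ∷ xs ]⇓ v
  precS⇓ : ∀ {f : Rec n} {g xs y u v} →
           prec f g [ y ∷ xs ]⇓ u → g [ y ∷ u ∷ xs ]⇓ v →
           prec f g [ suc y ∷ xs ]⇓ v
  mu⇓    : ∀ {f : Rec (suc n)} {xs y} →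
           (∀ z → z < y → ∃[ u ] f [ z ∷ xs ]⇓ suc u) →
           f [ y ∷ xs ]⇓ 0 → mu f [ xs ]⇓ y

-- The characteristic function of S is μ-recursive.
ComputableSet : Pred ℕ ℓ → Set ℓ
ComputableSet S = ∃[ f ] ∀ c →
  (S c × f [ c ∷ [] ]⇓ 1) ⊎ (¬ S c × f [ c ∷ [] ]⇓ 0)

-- An injection ℕ × ℕ → ℕ, by unique factorisation.
⟪_,_⟫ : ℕ → ℕ → ℕ
⟪ a , b ⟫ = 2 ^ a * suc (2 * b)

-- Gödel codes; injective on Formula n for each n.
code : Formula n → ℕ
code (x ∈′ y) = ⟪ 0 , ⟪ toℕ x , toℕ y ⟫ ⟫
code (x ≐ y)  = ⟪ 1 , ⟪ toℕ x , toℕ y ⟫ ⟫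
code ⊥′       = ⟪ 2 , 0 ⟫
code (φ ⇒′ ψ) = ⟪ 3 , ⟪ code φ , code ψ ⟫ ⟫
code (φ ∧′ ψ) = ⟪ 4 , ⟪ code φ , code ψ ⟫ ⟫
code (φ ∨′ ψ) = ⟪ 5 , ⟪ code φ , code ψ ⟫ ⟫
code (∀′ φ)   = ⟪ 6 , code φ ⟫
code (∃′ φ)   = ⟪ 7 , code φ ⟫

ComputableType : Pred (Formula n) 0ℓ → Set
ComputableType p = ComputableSet (λ c → ∃[ φ ] p φ × code φ ≡ c)

-- In a type p(ȳ , x̄) with ȳ of length k and x̄ of length l, the first k
-- variables are ȳ and the remaining l are x̄.
module _ (M : Structure ℓ) {k l : ℕ} (p : Pred (Formula (k + l)) 0ℓ)
         (ā : Vec (Structure.Carrier M) k) where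

  private
    Tuple : Set ℓ
    Tuple = Vec (Structure.Carrier M) l

  FinitelyRealizable : Set ℓ
  FinitelyRealizable = (Δ : List (Formula (k + l))) → All p Δ →
    Σ[ x̄ ∈ Tuple ] All (λ φ → M ⊨ φ [ ā ++ x̄ ]) Δ

  Realized : Set ℓ
  Realized = Σ[ x̄ ∈ Tuple ] (∀ φ → p φ → M ⊨ φ [ ā ++ x̄ ])

ComputablySaturated : Structure ℓ → Set (lsuc 0ℓ ⊔ ℓ)
ComputablySaturated M =
  ∀ {k l} (ā : Vec (Structure.Carrier M) k) (p : Pred (Formula (k + l)) 0ℓ) →
  ComputableType p → FinitelyRealizable M p ā → Realized M p ā

{-# OPTIONS --safe #-}

-- Let M be a set in N and N a set in N′, with ω ill-founded in the sense of the outer model each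
-- time.  The standard numerals of N avoid the set in N′ without minimal element, so N has
-- nonstandard natural numbers.  A computable set is representable in N.  For each standard b, the
-- model N has a satisfaction class for the formulas of code < b over M, together with a tuple
-- that satisfies all those in the type: this is finite realizability.  By overspill the same
-- holds below some d with all numerals as elements.  Whatever such a class does at nonstandard
-- codes, at the code of an actual formula it agrees with truth in M: the tuple realizes the type.
--
-- The connectives have their constructive meaning in _⊨_[_], but foundation and separation make
-- truth in a model of ZFC decidable, which overspill requires.
module Submission where

open import Data.Empty using (⊥-elim)
open import Data.Fin.Base using (Fin; zero; suc; toℕ; fromℕ<; lift; _↑ʳ_; _↑ˡ_)
import Data.Fin.Properties as Fin
open import Data.List.Base using (List; []; _∷_)
open import Data.List.Membership.Propositional using () renaming (_∈_ to _∈ᴸ_)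
open import Data.List.Relation.Unary.All as All using (All; []; _∷_)
open import Data.List.Relation.Unary.Any using (Any)
open import Data.Nat.Base using (ℕ; zero; suc; _+_; _*_; _^_; _<_; _≤_; s≤s; z≤n)
import Data.Nat.Properties as ℕ
open import Data.Product.Base using (_×_; _,_; proj₁; proj₂; ∃; ∃-syntax; Σ-syntax)
open import Data.Sum.Base using (_⊎_; inj₁; inj₂; [_,_]′)
open import Data.Vec.Base using (Vec; []; _∷_; _++_; lookup; map; splitAt; tabulate)
open import Data.Vec.Functional using () renaming (_∷_ to _◂_)
open import Data.Vec.Properties
  using (lookup-map; lookup-++ˡ; lookup-++ʳ; tabulate∘lookup; tabulate-cong; lookup∘tabulate)
open import Function.Base using (_∘_; id)
open import Function.Bundles using (_⇔_; mk⇔; Equivalence)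
open import Function.Construct.Composition using (_⇔-∘_)
open import Function.Construct.Symmetry using (⇔-sym)
open import Level using (Level; 0ℓ; lower) renaming (lift to raise)
open import Relation.Binary.Definitions using (tri<; tri≈; tri>)
open import Relation.Binary.PropositionalEquality
  using (_≡_; _≢_; refl; sym; trans; cong; cong₂; subst)
open import Relation.Nullary.Negation.Core using (¬_)
open import Relation.Unary using (Pred)
open import Defs

open Equivalence using (to; from)
open Multiverse using (models)

private
  variable
    ℓ ℓ′ : Level
    n k : ℕ

module _ {A : Set ℓ} {B : Set ℓ′} where

  ×⇒⇔ : (A → B) × (B → A) → A ⇔ B
  ×⇒⇔ (f , g) = mk⇔ f g

  ⇔⇒× : A ⇔ B → (A → B) × (B → A)
  ⇔⇒× e = to e , from e

-- Arithmetic and pairing as μ-recursive functions.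

constant : ℕ → Rec n
constant zero    = zer
constant (suc c) = comp succ (constant c ∷ [])

addition multiplication : Rec 2
addition       = prec (proj #0) (comp succ (proj #1 ∷ []))
multiplication = prec zer (comp addition (proj #2 ∷ proj #1 ∷ []))

module _ {f : Rec k} where

  comp₁⇓ : ∀ {g : Rec 1} {xs y v} → f [ xs ]⇓ y → g [ y ∷ [] ]⇓ v → comp g (f ∷ []) [ xs ]⇓ v
  comp₁⇓ f⇓ = comp⇓ λ { zero → f⇓ }

  comp₂⇓ : ∀ {f′ : Rec k} {g : Rec 2} {xs y y′ v} → f [ xs ]⇓ y → f′ [ xs ]⇓ y′ →
           g [ y ∷ y′ ∷ [] ]⇓ v → comp g (f ∷ f′ ∷ []) [ xs ]⇓ v
  comp₂⇓ f⇓ f′⇓ = comp⇓ λ { zero → f⇓ ; (suc zero) → f′⇓ }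

constant⇓ : ∀ c {xs : Vec ℕ n} → constant c [ xs ]⇓ c
constant⇓ zero    = zer⇓
constant⇓ (suc c) = comp₁⇓ (constant⇓ c) succ⇓

addition⇓ : ∀ x y → addition [ x ∷ y ∷ [] ]⇓ x + y
addition⇓ zero    y = precZ⇓ proj⇓
addition⇓ (suc x) y = precS⇓ (addition⇓ x y) (comp₁⇓ proj⇓ succ⇓)

multiplication⇓ : ∀ x y → multiplication [ x ∷ y ∷ [] ]⇓ x * y
multiplication⇓ zero    y = precZ⇓ zer⇓
multiplication⇓ (suc x) y =
  precS⇓ (multiplication⇓ x y) (comp₂⇓ proj⇓ proj⇓ (addition⇓ y (x * y)))

powerOfTwo : Rec 1
powerOfTwo = prec (constant 1) (comp multiplication (constant 2 ∷ proj #1 ∷ []))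

powerOfTwo⇓ : ∀ a → powerOfTwo [ a ∷ [] ]⇓ 2 ^ a
powerOfTwo⇓ zero    = precZ⇓ (constant⇓ 1)
powerOfTwo⇓ (suc a) =
  precS⇓ (powerOfTwo⇓ a) (comp₂⇓ (constant⇓ 2) proj⇓ (multiplication⇓ 2 (2 ^ a)))

-- Abstract, so that the formulas graph pairing-function and graph (tagged t) are never unfolded.
abstract
  pairing-function : Rec 2
  pairing-function = comp multiplication
    ( comp powerOfTwo (proj #0 ∷ [])
    ∷ comp succ (comp multiplication (constant 2 ∷ proj #1 ∷ []) ∷ []) ∷ [])

  pairing-function⇓ : ∀ a b → pairing-function [ a ∷ b ∷ [] ]⇓ ⟪ a , b ⟫
  pairing-function⇓ a b = comp₂⇓
    (comp₁⇓ proj⇓ (powerOfTwo⇓ a))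
    (comp₁⇓ (comp₂⇓ (constant⇓ 2) proj⇓ (multiplication⇓ 2 b)) succ⇓)
    (multiplication⇓ (2 ^ a) (suc (2 * b)))

  tagged : ℕ → Rec 1
  tagged t = comp pairing-function (constant t ∷ proj #0 ∷ [])

  tagged⇓ : ∀ t b → tagged t [ b ∷ [] ]⇓ ⟪ t , b ⟫
  tagged⇓ t b = comp₂⇓ (constant⇓ t) proj⇓ (pairing-function⇓ t b)

-- Bounds and injectivity for the pairing of numbers.

n<2^n : ∀ n → n < 2 ^ n
n<2^n zero    = s≤s z≤n
n<2^n (suc n) = ℕ.≤-trans (ℕ.+-mono-≤ (ℕ.m^n>0 2 n) (n<2^n n))
  (ℕ.+-monoʳ-≤ (2 ^ n) (ℕ.m≤m+n (2 ^ n) 0))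

-- Because both components lie below the code, Tarski's clauses can search for them among its
-- elements, and the codes of subformulas decrease.
⟪,⟫-<ˡ : ∀ a b → a < ⟪ a , b ⟫
⟪,⟫-<ˡ a b = ℕ.≤-trans (n<2^n a) (ℕ.m≤m*n (2 ^ a) (suc (2 * b)))

⟪,⟫-<ʳ : ∀ a b → b < ⟪ a , b ⟫
⟪,⟫-<ʳ a b = ℕ.≤-trans (s≤s (ℕ.m≤m+n b (b + 0)))
  (ℕ.m≤n*m (suc (2 * b)) (2 ^ a) {{ℕ.m^n≢0 2 a}})

-- Factors of 2 are cancelled one at a time. When only one exponent is zero, one side is odd and the
-- other even.
⟪,⟫-injective : ∀ a b a′ b′ → ⟪ a , b ⟫ ≡ ⟪ a′ , b′ ⟫ → a ≡ a′ × b ≡ b′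
⟪,⟫-injective zero b zero b′ eq = refl , ℕ.*-cancelˡ-≡ b b′ 2
  (ℕ.suc-injective (trans (sym (ℕ.*-identityˡ _)) (trans eq (ℕ.*-identityˡ _))))
⟪,⟫-injective zero b (suc a′) b′ eq = ⊥-elim (ℕ.even≢odd ⟪ a′ , b′ ⟫ b
  (trans (sym (ℕ.*-assoc 2 (2 ^ a′) _)) (trans (sym eq) (ℕ.*-identityˡ _))))
⟪,⟫-injective (suc a) b zero b′ eq = ⊥-elim (ℕ.even≢odd ⟪ a , b ⟫ b′
  (trans (sym (ℕ.*-assoc 2 (2 ^ a) _)) (trans eq (ℕ.*-identityˡ _))))
⟪,⟫-injective (suc a) b (suc a′) b′ eq
  with ⟪,⟫-injective a b a′ b′ (ℕ.*-cancelˡ-≡ ⟪ a , b ⟫ ⟪ a′ , b′ ⟫ 2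
         (trans (sym (ℕ.*-assoc 2 (2 ^ a) _)) (trans eq (ℕ.*-assoc 2 (2 ^ a′) _))))
... | refl , b≡b′ = refl , b≡b′

-- Formulas for recursive graphs and for satisfaction.

pattern #4 = suc #3
pattern #5 = suc #4
pattern #6 = suc #5
pattern #7 = suc #6
pattern #8 = suc #7

infixr 10 ∃^

∃^ : ∀ k → Formula (k + n) → Formula n
∃^ zero    φ = φ
∃^ (suc k) φ = ∃^ k (∃′ φ)

-- graph f says that its variable 0 is the value of f at the others.  For primitive recursion it
-- asks for a set of pairs, each justified by the base case or by another pair of the set.
graph : Rec n → Formula (suc n)
-- The maps `xs` and `ys` locate the common arguments and the individual values among the ambient
-- variables.
graphs : Vec (Rec n) k → ∀ {r} → (Fin n → Fin r) → (Fin k → Fin r) → Formula r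

graph zer = empty #0
graph succ = successor #0 #1
graph (proj i) = #0 ≐ suc i
graph {n} (comp {k} f gs) = ∃^ k
  (  graphs gs (λ j → k ↑ʳ suc j) (_↑ˡ suc n)
  ∧′ rename ((k ↑ʳ zero) ◂ (_↑ˡ suc n)) (graph f))
graph (prec f g) = ∃′
  (  related #2 #0 #1
  ∧′ ∀′ (#0 ∈′ #1 ⇒′
       ∃′ ∃′ (empty #1 ∧′ orderedPair #2 #1 #0 ∧′ rename (#0 ◂ (6 ↑ʳ_)) (graph f))
    ∨′ ∃′ ∃′ ∃′ ∃′
       (  successor #1 #3
       ∧′ orderedPair #4 #1 #0
       ∧′ related #3 #5 #2
       ∧′ rename (#0 ◂ #3 ◂ #2 ◂ (8 ↑ʳ_)) (graph g))))
graph (mu f) =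
     ∃′ (omega #0 ∧′ #1 ∈′ #0)
  ∧′ ∃′ (empty #0 ∧′ rename (#0 ◂ #1 ◂ (2 ↑ʳ_)) (graph f))
  ∧′ ∀′ (#0 ∈′ #1 ⇒′ ∃′ (nonempty #0 ∧′ rename (#0 ◂ #1 ◂ (3 ↑ʳ_)) (graph f)))

graphs []       xs ys = ⊥′ ⇒′ ⊥′
graphs (g ∷ gs) xs ys = rename (ys zero ◂ xs) (graph g) ∧′ graphs gs xs (ys ∘ suc)

-- The clause for a code `c` may consult only that part of a satisfaction class whose codes are
-- elements of `c`; this makes the definition of the class a recursion.
restriction : (R S c : Fin n) → Formula n
restriction R S c = ∀′ (#0 ∈′ suc R ⇔′
  #0 ∈′ suc S ∧′ ∃′ ∃′ (#1 ∈′ (3 ↑ʳ c) ∧′ orderedPair #2 #1 #0))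

-- Finite sequences over m are functions on numerals; e′ is e with some a ∈ m prepended.
prepended : (e′ e m : Fin n) → Formula n
prepended e′ e m = ∃′ (#0 ∈′ suc m ∧′ ∀′ (#0 ∈′ (2 ↑ʳ e′) ⇔′
     (∃′ (empty #0 ∧′ orderedPair #1 #0 #2)
  ∨′ ∃′ ∃′ ∃′ (related #0 (5 ↑ʳ e) #2 ∧′ successor #1 #0 ∧′ orderedPair #3 #1 #2))))

-- Variables R, b, e, m, E; if b = ⟪ x , y ⟫ then χ holds of y, x and these.
split : Formula 7 → Formula 5
split χ = ∃′ ∃′
  (#0 ∈′ #3 ∧′ #1 ∈′ #3 ∧′ rename (#3 ◂ #1 ◂ #0 ◂ λ ()) (graph pairing-function) ∧′ χ)

-- Tarski's clauses for the formula with code ⟪ t , b ⟫, assignment e and structure ⟨m , E⟩;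
-- R relates the codes of the subformulas to the assignments satisfying them.
clauses : Vec (Formula 5) 8
clauses =
    split (∃′ ∃′ (related #3 #6 #1 ∧′ related #2 #6 #0 ∧′ related #1 #8 #0))
  ∷ split (∃′ (related #2 #5 #0 ∧′ related #1 #5 #0))
  ∷ ⊥′
  ∷ split (related #1 #2 #4 ⇒′ related #0 #2 #4)
  ∷ split (related #1 #2 #4 ∧′ related #0 #2 #4)
  ∷ split (related #1 #2 #4 ∨′ related #0 #2 #4)
  ∷ ∀′ (prepended #0 #3 #4 ⇒′ related #2 #1 #0)
  ∷ ∃′ (prepended #0 #3 #4 ∧′ related #2 #1 #0)
  ∷ []

⋁ : (Fin k → Formula n) → Formula n
⋁ {zero}  φ = ⊥′
⋁ {suc k} φ = φ zero ∨′ ⋁ (φ ∘ suc)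

-- Variables R, c, e, m, E.
tarskiFor : Fin 8 → Formula 5
tarskiFor t = ∃′
  (  #0 ∈′ #2
  ∧′ rename (#2 ◂ #0 ◂ λ ()) (graph (tagged (toℕ t)))
  ∧′ rename (#1 ◂ #0 ◂ (3 ↑ʳ_)) (lookup clauses t))

opaque
  tarski : Formula 5
  tarski = ⋁ tarskiFor

opaque
  -- Variables S, d, A, m, E.
  satisfactionClass : Formula 5
  satisfactionClass = ∀′ (#0 ∈′ #2 ⇒′ ∀′ (#0 ∈′ #4 ⇒′
    (related #1 #2 #0 ⇔′
      ∃′ (restriction #0 #3 #2 ∧′ rename (#0 ◂ #2 ◂ #1 ◂ (6 ↑ʳ_)) tarski))))

-- This describes a function from `n` to `m`, in the same coding of finite sequences as `prepended`.
sequence : (e n m : Fin k) → Formula k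
sequence e n m =
     ∀′ (#0 ∈′ suc e ⇒′ ∃′ ∃′ (#1 ∈′ (3 ↑ʳ n) ∧′ orderedPair #2 #1 #0))
  ∧′ ∀′ (#0 ∈′ suc n ⇒′ ∃′ (#0 ∈′ (2 ↑ʳ m) ∧′ ∀′ (related #2 (3 ↑ʳ e) #0 ⇔′ #0 ≐ #1)))

lookup-extensional : ∀ {a} {A : Set a} (xs ys : Vec A n) →
                     (∀ i → lookup xs i ≡ lookup ys i) → xs ≡ ys
lookup-extensional xs ys h =
  trans (sym (tabulate∘lookup xs)) (trans (tabulate-cong h) (tabulate∘lookup ys))

-- Satisfaction under renaming and iterated connectives.

module Semantics (N : Structure ℓ) where
  open Structure N using (_∈_) renaming (Carrier to V)

  ⊨-rename : (ρ : Fin n → Fin k) (φ : Formula n) {d : Vec V k} {e : Vec V n} →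
             (∀ i → lookup d (ρ i) ≡ lookup e i) →
             (N ⊨ rename ρ φ [ d ]) ⇔ (N ⊨ φ [ e ])
  ⊨-rename-lift : (ρ : Fin n → Fin k) (φ : Formula (suc n)) {d : Vec V k} {e : Vec V n} →
                  (∀ i → lookup d (ρ i) ≡ lookup e i) → ∀ a →
                  (N ⊨ rename (lift 1 ρ) φ [ a ∷ d ]) ⇔ (N ⊨ φ [ a ∷ e ])

  ⊨-rename ρ (x ∈′ y) {d} {e} h = mk⇔ (subst id eq) (subst id (sym eq))
    where
    eq : (lookup d (ρ x) ∈ lookup d (ρ y)) ≡ (lookup e x ∈ lookup e y)
    eq = cong₂ _∈_ (h x) (h y)
  ⊨-rename ρ (x ≐ y) h =
    mk⇔ (λ p → trans (sym (h x)) (trans p (h y)))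
        (λ p → trans (h x) (trans p (sym (h y))))
  ⊨-rename ρ ⊥′ h = mk⇔ id id
  ⊨-rename ρ (φ ⇒′ ψ) h = mk⇔
    (λ f → to (⊨-rename ρ ψ h) ∘ f ∘ from (⊨-rename ρ φ h))
    (λ f → from (⊨-rename ρ ψ h) ∘ f ∘ to (⊨-rename ρ φ h))
  ⊨-rename ρ (φ ∧′ ψ) h = mk⇔
    (λ (p , q) → to (⊨-rename ρ φ h) p , to (⊨-rename ρ ψ h) q)
    (λ (p , q) → from (⊨-rename ρ φ h) p , from (⊨-rename ρ ψ h) q)
  ⊨-rename ρ (φ ∨′ ψ) h = mk⇔
    [ inj₁ ∘ to (⊨-rename ρ φ h) , inj₂ ∘ to (⊨-rename ρ ψ h) ]′
    [ inj₁ ∘ from (⊨-rename ρ φ h) , inj₂ ∘ from (⊨-rename ρ ψ h) ]′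
  ⊨-rename ρ (∀′ φ) h = mk⇔
    (λ f a → to (⊨-rename-lift ρ φ h a) (f a))
    (λ f a → from (⊨-rename-lift ρ φ h a) (f a))
  ⊨-rename ρ (∃′ φ) h = mk⇔
    (λ (a , p) → a , to (⊨-rename-lift ρ φ h a) p)
    (λ (a , p) → a , from (⊨-rename-lift ρ φ h a) p)

  ⊨-rename-lift ρ φ h a = ⊨-rename (lift 1 ρ) φ λ { zero → refl ; (suc i) → h i }

  ⊨-∃^ : ∀ k (φ : Formula (k + n)) {e : Vec V n} →
         (N ⊨ ∃^ k φ [ e ]) ⇔ (Σ[ ys ∈ Vec V k ] N ⊨ φ [ ys ++ e ])
  ⊨-∃^ zero    φ = mk⇔ (λ p → [] , p) λ { ([] , p) → p }
  ⊨-∃^ (suc k) φ = mk⇔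
    (λ p → let ys , y , q = to (⊨-∃^ k (∃′ φ)) p in y ∷ ys , q)
    (λ { (y ∷ ys , q) → from (⊨-∃^ k (∃′ φ)) (ys , y , q) })

  ⊨-⋁ : (φ : Fin k → Formula n) {e : Vec V n} → (N ⊨ ⋁ φ [ e ]) ⇔ (∃[ i ] N ⊨ φ i [ e ])
  ⊨-⋁ {zero}  φ = mk⇔ (λ ()) λ { (() , _) }
  ⊨-⋁ {suc k} φ = mk⇔
    [ (λ p → zero , p) , (λ p → let i , q = to (⊨-⋁ (φ ∘ suc)) p in suc i , q) ]′
    λ { (zero , p) → inj₁ p ; (suc i , p) → inj₂ (from (⊨-⋁ (φ ∘ suc)) (i , p)) }

  ⊨-closure : (φ : Formula n) → N ⊨ closure φ [ [] ] → ∀ e → N ⊨ φ [ e ]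
  ⊨-closure {zero}  φ h []      = h
  ⊨-closure {suc n} φ h (a ∷ e) = ⊨-closure (∀′ φ) h e a

-- Elementary set theory inside a model of ZFC.

module SetTheory (N : Structure ℓ) (zfc : N ⊨ZFC) where
  open Structure N using (_∈_) renaming (Carrier to V)
  open Semantics N

  extensional : ∀ {x y} → (∀ z → z ∈ x ⇔ z ∈ y) → x ≡ y
  extensional h = zfc extensionality′ _ _ (λ z → ⇔⇒× (h z))

  ∈-minimal : ∀ {a x} → a ∈ x → ∃[ y ] y ∈ x × (∀ z → z ∈ y → ¬ (z ∈ x))
  ∈-minimal {a} {x} a∈x with zfc foundation′ x (a , a∈x)
  ... | y , y∈x , min = y , y∈x , λ z z∈y z∈x → lower (min z z∈y z∈x)

  comprehension : (φ : Formula (suc n)) (e : Vec V n) (a : V) →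
                  ∃[ b ] ∀ x → x ∈ b ⇔ (x ∈ a × N ⊨ φ [ x ∷ e ])
  comprehension {n} φ e a with ⊨-closure _ (zfc (separation′ φ)) e a
  ... | b , h = b , λ x → mk⇔
    (λ x∈b → proj₁ (proj₁ (h x) x∈b) , to (renamed x) (proj₂ (proj₁ (h x) x∈b)))
    (λ (x∈a , p) → proj₂ (h x) (x∈a , from (renamed x) p))
    where
    renamed : ∀ x → (N ⊨ rename (lift 1 (2 ↑ʳ_)) φ [ x ∷ b ∷ a ∷ e ]) ⇔ (N ⊨ φ [ x ∷ e ])
    renamed x = ⊨-rename (lift 1 (2 ↑ʳ_)) φ λ { zero → refl ; (suc i) → refl }

  abstract
    -- The empty set is taken from the axiom of infinity, which asserts that an inductive set
    -- contains one.
    ∅ : V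
    ∅ = proj₁ (proj₁ (proj₂ (zfc infinity′)))

    ∉∅ : ∀ {x} → ¬ (x ∈ ∅)
    ∉∅ {x} p = lower (proj₁ (proj₂ (proj₁ (proj₂ (zfc infinity′)))) x p)

    pair : V → V → V
    pair a b = proj₁ (zfc pairing′ a b)

    ∈-pair : ∀ {a b x} → x ∈ pair a b ⇔ (x ≡ a ⊎ x ≡ b)
    ∈-pair {a} {b} {x} = ×⇒⇔ (proj₂ (zfc pairing′ a b) x)

    ⋃ : V → V
    ⋃ x = proj₁ (zfc union′ x)

    ∈-⋃ : ∀ {x z} → z ∈ ⋃ x ⇔ (∃[ y ] y ∈ x × z ∈ y)
    ∈-⋃ {x} {z} = ×⇒⇔ (proj₂ (zfc union′ x) z)

    𝒫 : V → V
    𝒫 x = proj₁ (zfc powerSet′ x)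

    ∈-𝒫 : ∀ {x z} → z ∈ 𝒫 x ⇔ (∀ y → y ∈ z → y ∈ x)
    ∈-𝒫 {x} {z} = ×⇒⇔ (proj₂ (zfc powerSet′ x) z)

  infixr 6 _∪_
  _∪_ : V → V → V
  a ∪ b = ⋃ (pair a b)

  ∈-∪ : ∀ {a b x} → x ∈ a ∪ b ⇔ (x ∈ a ⊎ x ∈ b)
  ∈-∪ {a} {b} {x} = mk⇔ f
    [ (λ p → from ∈-⋃ (a , from ∈-pair (inj₁ refl) , p))
    , (λ p → from ∈-⋃ (b , from ∈-pair (inj₂ refl) , p)) ]′
    where
    f : x ∈ a ∪ b → x ∈ a ⊎ x ∈ b
    f p with to ∈-⋃ p
    ... | y , q , r with to ∈-pair q
    ... | inj₁ refl = inj₁ r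
    ... | inj₂ refl = inj₂ r

  ｛_｝ : V → V
  ｛ a ｝ = pair a a

  ∈-singleton : ∀ {a x} → x ∈ ｛ a ｝ ⇔ x ≡ a
  ∈-singleton = mk⇔ ([ id , id ]′ ∘ to ∈-pair) (from ∈-pair ∘ inj₁)

  ∉-self : ∀ {x} → ¬ (x ∈ x)
  ∉-self {x} x∈x with ∈-minimal {x} {｛ x ｝} (from ∈-singleton refl)
  ... | y , y∈ , min with to ∈-singleton y∈
  ... | refl = min y x∈x y∈

  S⁺ : V → V
  S⁺ x = x ∪ ｛ x ｝

  ∈-S⁺ : ∀ {x z} → z ∈ S⁺ x ⇔ (z ∈ x ⊎ z ≡ x)
  ∈-S⁺ = mk⇔ ([ inj₁ , inj₂ ∘ to ∈-singleton ]′ ∘ to ∈-∪)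
             (from ∈-∪ ∘ [ inj₁ , inj₂ ∘ from ∈-singleton ]′)

  ⊨successor : ∀ {y x} → (N ⊨ successor #0 #1 [ y ∷ x ∷ [] ]) ⇔ y ≡ S⁺ x
  ⊨successor {y} {x} = mk⇔
    (λ h → extensional λ z → mk⇔ (from ∈-S⁺ ∘ proj₁ (h z)) (proj₂ (h z) ∘ to ∈-S⁺))
    λ { refl z → to ∈-S⁺ , from ∈-S⁺ }

  ⊨empty : ∀ {x} → (N ⊨ empty #0 [ x ∷ [] ]) ⇔ x ≡ ∅
  ⊨empty {x} = mk⇔
    (λ h → extensional λ z → mk⇔ (λ p → ⊥-elim (lower (h z p))) (λ p → ⊥-elim (∉∅ p)))
    λ { refl z p → ⊥-elim (∉∅ p) }

  num : ℕ → V
  num zero    = ∅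
  num (suc n) = S⁺ (num n)

  -- Standard numerals acquire no nonstandard elements, so bounded quantifiers over them in the
  -- model become quantifiers over actual numbers.
  ∈-num : ∀ {x} n → x ∈ num n ⇔ (∃[ i ] i < n × x ≡ num i)
  ∈-num zero = mk⇔ (λ p → ⊥-elim (∉∅ p)) λ { (_ , () , _) }
  ∈-num {x} (suc n) = mk⇔ f g
    where
    f : x ∈ num (suc n) → ∃[ i ] i < suc n × x ≡ num i
    f p with to ∈-S⁺ p
    ... | inj₂ eq = n , ℕ.n<1+n n , eq
    ... | inj₁ q with to (∈-num n) q
    ... | i , i<n , eq = i , ℕ.m<n⇒m<1+n i<n , eq
    g : (∃[ i ] i < suc n × x ≡ num i) → x ∈ num (suc n)
    g (i , i<sn , eq) with ℕ.m<1+n⇒m<n∨m≡n i<sn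
    ... | inj₁ i<n  = from ∈-S⁺ (inj₁ (from (∈-num n) (i , i<n , eq)))
    ... | inj₂ refl = from ∈-S⁺ (inj₂ eq)

  num-mono : ∀ {i j} → i < j → num i ∈ num j
  num-mono {i} {j} i<j = from (∈-num j) (i , i<j , refl)

  num-injective : ∀ {i j} → num i ≡ num j → i ≡ j
  num-injective {i} {j} eq with ℕ.<-cmp i j
  ... | tri< i<j _ _ = ⊥-elim (∉-self (subst (_∈ num j) eq (num-mono i<j)))
  ... | tri≈ _ i≡j _ = i≡j
  ... | tri> _ _ j<i = ⊥-elim (∉-self (subst (_∈ num i) (sym eq) (num-mono j<i)))

  ⊨unorderedPair : ∀ {z x y} → (N ⊨ unorderedPair #0 #1 #2 [ z ∷ x ∷ y ∷ [] ]) ⇔ z ≡ pair x y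
  ⊨unorderedPair = mk⇔
    (λ h → extensional λ t → mk⇔ (from ∈-pair ∘ proj₁ (h t)) (proj₂ (h t) ∘ to ∈-pair))
    λ { refl t → to ∈-pair , from ∈-pair }

  ⟨_,_⟩ : V → V → V
  ⟨ a , b ⟩ = pair ｛ a ｝ (pair a b)

  ⊨orderedPair : ∀ {z x y} → (N ⊨ orderedPair #0 #1 #2 [ z ∷ x ∷ y ∷ [] ]) ⇔ z ≡ ⟨ x , y ⟩
  ⊨orderedPair {z} {x} {y} = mk⇔ f g
    where
    f : N ⊨ orderedPair #0 #1 #2 [ z ∷ x ∷ y ∷ [] ] → z ≡ ⟨ x , y ⟩
    f (u , v , p , q , r) with to ⊨unorderedPair p | to ⊨unorderedPair q
    ... | refl | refl = to ⊨unorderedPair r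
    g : z ≡ ⟨ x , y ⟩ → N ⊨ orderedPair #0 #1 #2 [ z ∷ x ∷ y ∷ [] ]
    g eq = _ , _ , from ⊨unorderedPair refl , from ⊨unorderedPair refl , from ⊨unorderedPair eq

  ⊨related : ∀ {x r y} → (N ⊨ related #0 #1 #2 [ x ∷ r ∷ y ∷ [] ]) ⇔ ⟨ x , y ⟩ ∈ r
  ⊨related {x} {r} {y} = mk⇔
    (λ (p , q , p∈r) → subst (_∈ r) (to ⊨orderedPair q) p∈r)
    (λ p∈r → _ , from ⊨orderedPair refl , p∈r)

  pair-injectiveʳ : ∀ {a b c} → pair a b ≡ pair a c → b ≡ c
  pair-injectiveʳ {a} {b} {c} eq
    with to ∈-pair (subst (b ∈_) eq (from ∈-pair (inj₂ refl)))
       | to ∈-pair (subst (c ∈_) (sym eq) (from ∈-pair (inj₂ refl)))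
  ... | inj₂ b≡c | _        = b≡c
  ... | inj₁ b≡a | inj₁ c≡a = trans b≡a (sym c≡a)
  ... | inj₁ b≡a | inj₂ c≡b = sym c≡b

  singleton≡pair : ∀ {a b c} → ｛ a ｝ ≡ pair b c → a ≡ b
  singleton≡pair {a} {b} eq = sym (to ∈-singleton (subst (b ∈_) (sym eq) (from ∈-pair (inj₁ refl))))

  ⟨,⟩-injective : ∀ {a b c d} → ⟨ a , b ⟩ ≡ ⟨ c , d ⟩ → a ≡ c × b ≡ d
  ⟨,⟩-injective {a} {b} {c} {d} eq
    with [ singleton≡pair , singleton≡pair ]′
           (to ∈-pair (subst (｛ a ｝ ∈_) eq (from ∈-pair (inj₁ refl))))
  ... | refl = refl , pair-injectiveʳ (pair-injectiveʳ eq)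

  -- If φ fails, then 0 is not in {x ∈ 2 : x = 1 ∨ φ}, whose ∈-minimal element is thus 1.
  excludedMiddle : (φ : Formula n) (e : Vec V n) → N ⊨ φ [ e ] ⊎ ¬ (N ⊨ φ [ e ])
  excludedMiddle φ e
    with comprehension (#0 ≐ #1 ∨′ rename (2 ↑ʳ_) φ) (num 1 ∷ e) (num 2)
  ... | b , ∈-b = decide (∈-minimal 1∈b)
    where
    1∈b : num 1 ∈ b
    1∈b = from (∈-b (num 1)) (num-mono {1} {2} (s≤s (s≤s z≤n)) , inj₁ refl)
    renamed : ∀ x → (N ⊨ rename (2 ↑ʳ_) φ [ x ∷ num 1 ∷ e ]) ⇔ (N ⊨ φ [ e ])
    renamed x = ⊨-rename (2 ↑ʳ_) φ λ _ → refl
    decide : (∃[ x ] x ∈ b × (∀ z → z ∈ x → ¬ (z ∈ b))) → N ⊨ φ [ e ] ⊎ ¬ (N ⊨ φ [ e ])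
    decide (x , x∈b , min) with proj₂ (to (∈-b x) x∈b)
    ... | inj₂ p    = inj₁ (to (renamed x) p)
    ... | inj₁ refl = inj₂ λ p → min ∅ (num-mono {0} {1} (s≤s z≤n))
      (from (∈-b ∅) (num-mono {0} {2} (s≤s z≤n) , inj₂ (from (renamed ∅) p)))

  -- Induction on ω, nonstandard numbers and overspill.

  record Inductive (w : V) : Set ℓ where
    field
      ∅∈  : ∅ ∈ w
      S⁺∈ : ∀ {x} → x ∈ w → S⁺ x ∈ w

    num∈ : ∀ i → num i ∈ w
    num∈ zero    = ∅∈
    num∈ (suc i) = S⁺∈ (num∈ i)

  open Inductive

  ⊨inductive : ∀ {w} → (N ⊨ inductive′ #0 [ w ∷ [] ]) ⇔ Inductive w
  ⊨inductive {w} = mk⇔ f g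
    where
    f : N ⊨ inductive′ #0 [ w ∷ [] ] → Inductive w
    f ((z , z-empty , z∈w) , step) = record
      { ∅∈  = subst (_∈ w) (to ⊨empty z-empty) z∈w
      ; S⁺∈ = λ {x} x∈w → let y , y-succ , y∈w = step x x∈w in
                subst (_∈ w) (to ⊨successor y-succ) y∈w
      }
    g : Inductive w → N ⊨ inductive′ #0 [ w ∷ [] ]
    g ind = (∅ , from ⊨empty refl , ∅∈ ind)
          , λ x x∈w → S⁺ x , from ⊨successor refl , S⁺∈ ind x∈w

  infinite : ∃ Inductive
  infinite with zfc infinity′
  ... | w , ind = w , to ⊨inductive ind

  IsOmega : V → Set ℓ
  IsOmega w = N ⊨ omega #0 [ w ∷ [] ]

  -- Separation cuts out of `w` the elements satisfying `φ`. They form an inductive set, which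
  -- contains `w` by leastness.
  ω-induction : ∀ {w} → IsOmega w → (φ : Formula (suc n)) (e : Vec V n) →
                N ⊨ φ [ ∅ ∷ e ] →
                (∀ x → x ∈ w → N ⊨ φ [ x ∷ e ] → N ⊨ φ [ S⁺ x ∷ e ]) →
                ∀ x → x ∈ w → N ⊨ φ [ x ∷ e ]
  ω-induction {w = w} (ind , least) φ e base step x x∈w with comprehension φ e w
  ... | b , ∈-b = proj₂ (to (∈-b x) (least b (from ⊨inductive b-inductive) x x∈w))
    where
    b-inductive : Inductive b
    b-inductive = record
      { ∅∈  = from (∈-b _) (∅∈ (to ⊨inductive ind) , base)
      ; S⁺∈ = λ {y} y∈b → let y∈w , p = to (∈-b y) y∈b in
                from (∈-b _) (S⁺∈ (to ⊨inductive ind) y∈w , step y y∈w p)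
      }

  -- This is the intersection of all inductive sets, separated from the one given by infinity.
  omega-exists : ∃ IsOmega
  omega-exists with infinite
  ... | v , ind with comprehension (∀′ (inductive′ #0 ⇒′ #1 ∈′ #0)) [] v
  ... | w , ∈-w = w
    , from ⊨inductive (record
        { ∅∈  = from (∈-w ∅) (∅∈ ind , λ u u-ind → ∅∈ (to ⊨inductive u-ind))
        ; S⁺∈ = λ {x} x∈w → let x∈v , least = to (∈-w x) x∈w in
                  from (∈-w (S⁺ x))
                    (S⁺∈ ind x∈v , λ u u-ind → S⁺∈ (to ⊨inductive u-ind) (least u u-ind))
        })
    , λ u u-ind x x∈w → proj₂ (to (∈-w x) x∈w) u u-ind

  -- The induction on `x` takes place in the model, so its second alternative is the formula
  -- `x ∈ num (suc n)`; only afterwards does `∈-num` turn it into equality with an actual numeral.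
  ω-comparable : ∀ {w} → IsOmega w → ∀ n x → x ∈ w → num n ∈ x ⊎ (∃[ i ] i < suc n × x ≡ num i)
  ω-comparable isω n x x∈w =
    [ inj₁ , inj₂ ∘ to (∈-num (suc n)) ]′
      (ω-induction isω (#1 ∈′ #0 ∨′ #0 ∈′ #2) (num n ∷ num (suc n) ∷ [])
        (inj₂ (num-mono {0} {suc n} (s≤s z≤n))) step x x∈w)
    where
    step : ∀ x → _ → num n ∈ x ⊎ x ∈ num (suc n) → num n ∈ S⁺ x ⊎ S⁺ x ∈ num (suc n)
    step x _ (inj₁ p) = inj₁ (from ∈-S⁺ (inj₁ p))
    step x _ (inj₂ p) with to (∈-num (suc n)) p
    ... | i , i<sn , refl with ℕ.m<1+n⇒m<n∨m≡n i<sn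
    ... | inj₁ i<n  = inj₂ (num-mono (s≤s i<n))
    ... | inj₂ refl = inj₁ (from ∈-S⁺ (inj₂ refl))

  ω-cases : ∀ {w} → IsOmega w → ∀ x → x ∈ w → x ≡ ∅ ⊎ (∃[ y ] y ∈ w × x ≡ S⁺ y)
  ω-cases {w} isω x x∈w =
    [ inj₁ ∘ to ⊨empty , (λ (y , y∈w , p) → inj₂ (y , y∈w , to ⊨successor p)) ]′
      (ω-induction isω (empty #0 ∨′ ∃′ (#0 ∈′ #2 ∧′ successor #1 #0)) (w ∷ [])
        (inj₁ (from ⊨empty refl))
        (λ y y∈w _ → inj₂ (y , y∈w , from ⊨successor refl)) x x∈w)

  Nonstandard : V → Set ℓ
  Nonstandard x = ∀ n → x ≢ num n

  num∈-nonstandard : ∀ {w x} → IsOmega w → x ∈ w → Nonstandard x → ∀ i → num i ∈ x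
  num∈-nonstandard isω x∈w nonstd i =
    [ id , (λ (j , _ , eq) → ⊥-elim (nonstd j eq)) ]′ (ω-comparable isω i _ x∈w)

  -- If φ fails at c, the least x at which it fails is a successor, and its predecessor will do.
  overspill : ∀ {w c} → IsOmega w → c ∈ w → Nonstandard c →
              (φ : Formula (suc n)) (e : Vec V n) → (∀ i → N ⊨ φ [ num i ∷ e ]) →
              ∃[ d ] (∀ i → num i ∈ d) × N ⊨ φ [ d ∷ e ]
  overspill {w = w} {c} isω c∈w c-nonstd φ e standard with excludedMiddle φ (c ∷ e)
  ... | inj₁ p = c , num∈-nonstandard isω c∈w c-nonstd , p
  ... | inj₂ ¬p with comprehension (¬′ φ) e w
  ... | b , ∈-b = least (∈-minimal (from (∈-b c) (c∈w , raise ∘ ¬p)))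
    where
    least : (∃[ x ] x ∈ b × (∀ z → z ∈ x → ¬ (z ∈ b))) →
            ∃[ d ] (∀ i → num i ∈ d) × N ⊨ φ [ d ∷ e ]
    least (x , x∈b , min) with to (∈-b x) x∈b
    ... | x∈w , ¬φx with ω-cases isω x x∈w
    ... | inj₁ refl = ⊥-elim (lower (¬φx (standard 0)))
    ... | inj₂ (d , d∈w , refl) = d , num∈-nonstandard isω d∈w d-nonstd , φd
      where
      d-nonstd : Nonstandard d
      d-nonstd i refl = lower (¬φx (standard (suc i)))
      φd : N ⊨ φ [ d ∷ e ]
      φd = [ id
           , (λ ¬φd → ⊥-elim (min d (from ∈-S⁺ (inj₂ refl)) (from (∈-b d) (d∈w , raise ∘ ¬φd)))) ]′
             (excludedMiddle φ (d ∷ e))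

  finiteSet : (Fin n → V) → V
  finiteSet {zero}  g = ∅
  finiteSet {suc n} g = ｛ g zero ｝ ∪ finiteSet (g ∘ suc)

  ∈-finiteSet : ∀ {g : Fin n → V} {x} → x ∈ finiteSet g ⇔ (∃[ i ] x ≡ g i)
  ∈-finiteSet {zero}  = mk⇔ (λ p → ⊥-elim (∉∅ p)) λ { (() , _) }
  ∈-finiteSet {suc n} {g} {x} = mk⇔
    ([ (λ p → zero , to ∈-singleton p)
     , (λ p → let i , eq = to (∈-finiteSet {n}) p in suc i , eq) ]′ ∘ to ∈-∪)
    λ { (zero , eq)  → from ∈-∪ (inj₁ (from ∈-singleton eq))
      ; (suc i , eq) → from ∈-∪ (inj₂ (from (∈-finiteSet {n}) (i , eq))) }

  -- Representability of μ-recursive functions.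

  ∅≢S⁺ : ∀ {x} → ∅ ≢ S⁺ x
  ∅≢S⁺ {x} eq = ∉∅ (subst (x ∈_) (sym eq) (from ∈-S⁺ (inj₂ refl)))

  -- Being an element of its successor, `x` belongs to a numeral and is therefore a numeral;
  -- `num-injective` then identifies it.
  S⁺≡num : ∀ {x} n → S⁺ x ≡ num (suc n) → x ≡ num n
  S⁺≡num {x} n eq with to (∈-num (suc n)) (subst (x ∈_) eq (from ∈-S⁺ (inj₂ refl)))
  ... | i , _ , refl = cong num (ℕ.suc-injective (num-injective {suc i} {suc n} eq))

  -- The equivalence carries uniqueness as well as existence: at standard arguments no other element
  -- of the model, nonstandard ones included, satisfies the graph.
  record Represents (f : Rec n) (vs : Vec ℕ n) (v : ℕ) : Set ℓ where
    constructor represents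
    field
      ⊨graph : ∀ y → (N ⊨ graph f [ y ∷ map num vs ]) ⇔ y ≡ num v

  open Represents

  graphs-represent :
    (gs : Vec (Rec n) k) {vs : Vec ℕ n} {ws : Vec ℕ k} →
    (∀ i → Represents (lookup gs i) vs (lookup ws i)) →
    ∀ {r} (e : Vec V r) xs ys → (∀ j → lookup e (xs j) ≡ num (lookup vs j)) →
    (N ⊨ graphs gs xs ys [ e ]) ⇔ (∀ i → lookup e (ys i) ≡ num (lookup ws i))
  graphs-represent [] {ws = []} rep e xs ys h = mk⇔ (λ _ ()) (λ _ → id)
  graphs-represent (g ∷ gs) {vs} {w ∷ ws} rep e xs ys h = mk⇔
    (λ { (p , q) zero    → to (⊨graph (rep zero) _) (to renamed p)
       ; (p , q) (suc i) → to rest q i })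
    (λ eqs → from renamed (from (⊨graph (rep zero) _) (eqs zero)) , from rest (eqs ∘ suc))
    where
    renamed : (N ⊨ rename (ys zero ◂ xs) (graph g) [ e ]) ⇔
              (N ⊨ graph g [ lookup e (ys zero) ∷ map num vs ])
    renamed = ⊨-rename _ (graph g)
      λ { zero → refl ; (suc j) → trans (h j) (sym (lookup-map j num vs)) }
    rest : (N ⊨ graphs gs xs (ys ∘ suc) [ e ]) ⇔
           (∀ i → lookup e (ys (suc i)) ≡ num (lookup ws i))
    rest = graphs-represent gs {ws = ws} (rep ∘ suc) e xs (ys ∘ suc) h

  comp-represents : ∀ {f : Rec k} {gs : Vec (Rec n) k} {vs ws v} →
                    (∀ i → Represents (lookup gs i) vs (lookup ws i)) → Represents f ws v →
                    Represents (comp f gs) vs v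
  comp-represents {k} {n} {f} {gs} {vs} {ws} {v} gs-rep f-rep = represents λ y → mk⇔
    (λ p → let us , q , r = to (⊨-∃^ k body) p in
           to (⊨graph f-rep y) (to (renamed y us (to (values y us) q)) r))
    (λ eq → from (⊨-∃^ k body)
      ( map num ws
      , from (values y (map num ws)) (num-ws y)
      , from (renamed y (map num ws) (num-ws y)) (from (⊨graph f-rep y) eq)))
    where
    body : Formula (k + suc n)
    body = graphs gs (λ j → k ↑ʳ suc j) (_↑ˡ suc n)
        ∧′ rename ((k ↑ʳ zero) ◂ (_↑ˡ suc n)) (graph f)
    env : V → Vec V k → Vec V (k + suc n)
    env y us = us ++ (y ∷ map num vs)
    num-ws : ∀ y i → lookup (env y (map num ws)) (i ↑ˡ suc n) ≡ num (lookup ws i)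
    num-ws y i = trans (lookup-++ˡ (map num ws) _ i) (lookup-map i num ws)
    values : ∀ y us → (N ⊨ graphs gs (λ j → k ↑ʳ suc j) (_↑ˡ suc n) [ env y us ]) ⇔
                    (∀ i → lookup (env y us) (i ↑ˡ suc n) ≡ num (lookup ws i))
    values y us = graphs-represent gs {ws = ws} gs-rep (env y us) _ _
      λ j → trans (lookup-++ʳ us _ (suc j)) (lookup-map j num vs)
    renamed : ∀ y us → (∀ i → lookup (env y us) (i ↑ˡ suc n) ≡ num (lookup ws i)) →
              (N ⊨ rename ((k ↑ʳ zero) ◂ (_↑ˡ suc n)) (graph f) [ env y us ]) ⇔
              (N ⊨ graph f [ y ∷ map num ws ])
    renamed y us h = ⊨-rename _ (graph f)
      λ { zero → lookup-++ʳ us _ zero ; (suc i) → trans (h i) (sym (lookup-map i num ws)) }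

  module _ {f : Rec n} {g : Rec (suc (suc n))} (vs : Vec ℕ n) where

    -- The clause of graph (prec f g) on the elements p of the set h.
    Justified : (y x h p : V) → Set ℓ
    Justified y x h p =
        (∃[ z ] ∃[ u ] N ⊨ empty #0 [ z ∷ [] ] × N ⊨ orderedPair #0 #1 #2 [ p ∷ z ∷ u ∷ [] ]
           × N ⊨ rename (#0 ◂ (6 ↑ʳ_)) (graph f) [ u ∷ z ∷ p ∷ h ∷ y ∷ x ∷ map num vs ])
      ⊎ (∃[ j ] ∃[ r ] ∃[ i ] ∃[ u ] N ⊨ successor #0 #1 [ i ∷ j ∷ [] ]
           × N ⊨ orderedPair #0 #1 #2 [ p ∷ i ∷ u ∷ [] ]
           × N ⊨ related #0 #1 #2 [ j ∷ h ∷ r ∷ [] ]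
           × N ⊨ rename (#0 ◂ #3 ◂ #2 ◂ (8 ↑ʳ_)) (graph g)
               [ u ∷ i ∷ r ∷ j ∷ p ∷ h ∷ y ∷ x ∷ map num vs ])

    -- The same condition with the set-theoretic formulas evaluated and the renamings undone.
    Justified′ : (h p : V) → Set ℓ
    Justified′ h p =
        (∃[ u ] p ≡ ⟨ ∅ , u ⟩ × N ⊨ graph f [ u ∷ map num vs ])
      ⊎ (∃[ j ] ∃[ r ] ∃[ u ] p ≡ ⟨ S⁺ j , u ⟩ × ⟨ j , r ⟩ ∈ h
           × N ⊨ graph g [ u ∷ j ∷ r ∷ map num vs ])

    justified : ∀ {y x h p} → Justified y x h p ⇔ Justified′ h p
    justified {y} {x} {h} {p} = mk⇔ there back
      where
      f-renamed : ∀ z u → (N ⊨ rename (#0 ◂ (6 ↑ʳ_)) (graph f)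
                            [ u ∷ z ∷ p ∷ h ∷ y ∷ x ∷ map num vs ]) ⇔
                          (N ⊨ graph f [ u ∷ map num vs ])
      f-renamed z u = ⊨-rename _ (graph f) λ { zero → refl ; (suc j) → refl }
      g-renamed : ∀ u i r j → (N ⊨ rename (#0 ◂ #3 ◂ #2 ◂ (8 ↑ʳ_)) (graph g)
                                 [ u ∷ i ∷ r ∷ j ∷ p ∷ h ∷ y ∷ x ∷ map num vs ]) ⇔
                              (N ⊨ graph g [ u ∷ j ∷ r ∷ map num vs ])
      g-renamed u i r j = ⊨-rename _ (graph g)
        λ { zero → refl ; (suc zero) → refl ; (suc (suc zero)) → refl ; (suc (suc (suc j))) → refl }
      there : Justified y x h p → Justified′ h p
      there (inj₁ (z , u , a , b , c)) with to ⊨empty a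
      ... | refl = inj₁ (u , to ⊨orderedPair b , to (f-renamed z u) c)
      there (inj₂ (j , r , i , u , a , b , c , d)) with to ⊨successor a
      ... | refl = inj₂ (j , r , u , to ⊨orderedPair b , to ⊨related c , to (g-renamed u i r j) d)
      back : Justified′ h p → Justified y x h p
      back (inj₁ (u , b , c)) =
        inj₁ (∅ , u , from ⊨empty refl , from ⊨orderedPair b , from (f-renamed ∅ u) c)
      back (inj₂ (j , r , u , b , c , d)) =
        inj₂ (j , r , S⁺ j , u , from ⊨successor refl , from ⊨orderedPair b , from ⊨related c
             , from (g-renamed u (S⁺ j) r j) d)

    ⊨prec : ∀ {y x} → (N ⊨ graph (prec f g) [ y ∷ x ∷ map num vs ]) ⇔
                      (∃[ h ] ⟨ x , y ⟩ ∈ h × (∀ p → p ∈ h → Justified′ h p))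
    ⊨prec = mk⇔
      (λ (h , p , q) → h , to ⊨related p , λ t t∈h → to justified (q t t∈h))
      (λ (h , p , q) → h , from ⊨related p , λ t t∈h → from justified (q t t∈h))

    prec-represents-zero : ∀ {v} → Represents f vs v → Represents (prec f g) (0 ∷ vs) v
    prec-represents-zero {v} f-rep = represents λ y → mk⇔ (there y ∘ to ⊨prec) (from ⊨prec ∘ back y)
      where
      there : ∀ y → (∃[ h ] ⟨ ∅ , y ⟩ ∈ h × (∀ p → p ∈ h → Justified′ h p)) → y ≡ num v
      there y (h , q , just) with just _ q
      ... | inj₁ (u , eq , r) with ⟨,⟩-injective eq
      ... | _ , refl = to (⊨graph f-rep y) r
      there y (h , q , just) | inj₂ (j , r , u , eq , _) = ⊥-elim (∅≢S⁺ (proj₁ (⟨,⟩-injective eq)))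
      back : ∀ y → y ≡ num v → ∃[ h ] ⟨ ∅ , y ⟩ ∈ h × (∀ p → p ∈ h → Justified′ h p)
      back y eq = ｛ ⟨ ∅ , y ⟩ ｝ , from ∈-singleton refl
              , λ p p∈ → inj₁ (y , to ∈-singleton p∈ , from (⊨graph f-rep y) eq)

    -- For uniqueness, the set `h` that witnesses the value at `suc x` also witnesses the value at
    -- `x` found inside it, because all its pairs are justified. For existence, a witness for `x` is
    -- enlarged by one pair; old justifications persist in the larger set.
    prec-represents-suc : ∀ {x u v} → Represents (prec f g) (x ∷ vs) u →
                          Represents g (x ∷ u ∷ vs) v → Represents (prec f g) (suc x ∷ vs) v
    prec-represents-suc {x} {u} {v} prec-rep g-rep =
      represents λ y → mk⇔ (there y ∘ to ⊨prec) (from ⊨prec ∘ back y)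
      where
      there : ∀ y → (∃[ h ] ⟨ num (suc x) , y ⟩ ∈ h × (∀ p → p ∈ h → Justified′ h p)) → y ≡ num v
      there y (h , q , just) with just _ q
      ... | inj₁ (_ , eq , r) = ⊥-elim (∅≢S⁺ (sym (proj₁ (⟨,⟩-injective eq))))
      ... | inj₂ (j , r , _ , eq , jr∈h , gr) with ⟨,⟩-injective eq
      ... | eq₁ , refl with S⁺≡num x (sym eq₁)
      ... | refl with to (⊨graph prec-rep r) (from ⊨prec (h , jr∈h , just))
      ... | refl = to (⊨graph g-rep y) gr
      back : ∀ y → y ≡ num v → ∃[ h ] ⟨ num (suc x) , y ⟩ ∈ h × (∀ p → p ∈ h → Justified′ h p)
      back y eq with to ⊨prec (from (⊨graph prec-rep (num u)) refl)
      ... | h , xu∈h , just = h ∪ ｛ ⟨ num (suc x) , y ⟩ ｝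
                            , from ∈-∪ (inj₂ (from ∈-singleton refl))
                            , λ p → [ old p , new p ]′ ∘ to ∈-∪
        where
        old : ∀ p → p ∈ h → Justified′ (h ∪ ｛ ⟨ num (suc x) , y ⟩ ｝) p
        old p p∈h with just p p∈h
        ... | inj₁ q = inj₁ q
        ... | inj₂ (j , r , w , eq , jr∈h , q) = inj₂ (j , r , w , eq , from ∈-∪ (inj₁ jr∈h) , q)
        new : ∀ p → p ∈ ｛ ⟨ num (suc x) , y ⟩ ｝ → Justified′ (h ∪ ｛ ⟨ num (suc x) , y ⟩ ｝) p
        new p p∈ = inj₂ (num x , num u , y , to ∈-singleton p∈
                        , from ∈-∪ (inj₁ xu∈h) , from (⊨graph g-rep y) eq)

  -- A candidate in ω is comparable with `num y`. If it lies above, the value of `f` at `y` would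
  -- have to be nonempty although it is 0; if it is a smaller numeral, the value there is a
  -- successor and cannot be empty.
  mu-represents : ∀ {f : Rec (suc n)} {vs y} →
                  (∀ z → z < y → ∃[ u ] Represents f (z ∷ vs) (suc u)) →
                  Represents f (y ∷ vs) 0 → Represents (mu f) vs y
  mu-represents {f = f} {vs} {y} below at = represents λ x → mk⇔ (there x) (back x)
    where
    renamed₂ : ∀ x z → (N ⊨ rename (#0 ◂ #1 ◂ (2 ↑ʳ_)) (graph f) [ z ∷ x ∷ map num vs ]) ⇔
                     (N ⊨ graph f [ z ∷ x ∷ map num vs ])
    renamed₂ x z = ⊨-rename _ (graph f) λ { zero → refl ; (suc zero) → refl ; (suc (suc j)) → refl }
    renamed₃ : ∀ x u z → (N ⊨ rename (#0 ◂ #1 ◂ (3 ↑ʳ_)) (graph f) [ u ∷ z ∷ x ∷ map num vs ]) ⇔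
                       (N ⊨ graph f [ u ∷ z ∷ map num vs ])
    renamed₃ x u z = ⊨-rename _ (graph f)
      λ { zero → refl ; (suc zero) → refl ; (suc (suc j)) → refl }
    there : ∀ x → N ⊨ graph (mu f) [ x ∷ map num vs ] → x ≡ num y
    there x ((w , isω , x∈w) , (z , z-empty , fz) , less) with to ⊨empty z-empty
    ... | refl with ω-comparable isω y x x∈w
    ... | inj₁ y∈x = let u , (t , t∈u) , fu = less (num y) y∈x in
            ⊥-elim (∉∅ (subst (t ∈_) (to (⊨graph at u) (to (renamed₃ x u (num y)) fu)) t∈u))
    ... | inj₂ (i , i<sy , refl) with ℕ.m<1+n⇒m<n∨m≡n i<sy
    ... | inj₂ refl = refl
    ... | inj₁ i<y  = ⊥-elim (∅≢S⁺ (to (⊨graph (proj₂ (below i i<y)) ∅) (to (renamed₂ _ ∅) fz)))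
    back : ∀ x → x ≡ num y → N ⊨ graph (mu f) [ x ∷ map num vs ]
    back _ refl =
        (ω , isω , num∈ (to ⊨inductive (proj₁ isω)) y)
      , (∅ , from ⊨empty refl , from (renamed₂ _ ∅) (from (⊨graph at ∅) refl))
      , less
      where
      ω : V
      ω = proj₁ omega-exists
      isω : IsOmega ω
      isω = proj₂ omega-exists
      less : ∀ z → z ∈ num y → ∃[ u ] (∃[ t ] t ∈ u) ×
             N ⊨ rename (#0 ◂ #1 ◂ (3 ↑ʳ_)) (graph f) [ u ∷ z ∷ num y ∷ map num vs ]
      less z z∈y with to (∈-num y) z∈y
      ... | i , i<y , refl = let u , r = below i i<y in
              S⁺ (num u) , (num u , from ∈-S⁺ (inj₂ refl))
              , from (renamed₃ _ _ _) (from (⊨graph r _) refl)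

  -- Induction on the evaluation. It follows that the formula for a computable set is correct at
  -- every standard numeral, whatever it says elsewhere.
  graph-represents : ∀ {f : Rec n} {vs v} → f [ vs ]⇓ v → Represents f vs v
  graph-represents zer⇓                 = represents λ y → ⊨empty
  graph-represents succ⇓                = represents λ y → ⊨successor
  graph-represents (proj⇓ {i = i} {vs}) = represents λ y → mk⇔
    (λ eq → trans eq (lookup-map i num vs)) (λ eq → trans eq (sym (lookup-map i num vs)))
  graph-represents (comp⇓ gs⇓ f⇓) =
    comp-represents (λ i → graph-represents (gs⇓ i)) (graph-represents f⇓)
  graph-represents (precZ⇓ {xs = xs} f⇓) =
    prec-represents-zero xs (graph-represents f⇓)
  graph-represents (precS⇓ {xs = xs} prec⇓ g⇓) =
    prec-represents-suc xs (graph-represents prec⇓) (graph-represents g⇓)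
  graph-represents (mu⇓ below f⇓) =
    mu-represents (λ z z<y → let u , d = below z z<y in u , graph-represents d)
                  (graph-represents f⇓)

  -- Restrictions of relations and recursion along standard numerals.

  ⟨,⟩∈𝒫𝒫 : ∀ {a b u} → a ∈ u → b ∈ u → ⟨ a , b ⟩ ∈ 𝒫 (𝒫 u)
  ⟨,⟩∈𝒫𝒫 {a} {b} {u} a∈u b∈u = from ∈-𝒫 λ y →
    [ (λ { refl → from ∈-𝒫 (sub a∈u) }) , (λ { refl → from ∈-𝒫 (sub b∈u) }) ]′ ∘ to ∈-pair
    where
    sub : ∀ {c} → c ∈ u → ∀ x → x ∈ pair a c → x ∈ u
    sub c∈u x p with to ∈-pair p
    ... | inj₁ refl = a∈u
    ... | inj₂ refl = c∈u

  restrict : V → V → V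
  restrict S c = proj₁ (comprehension (∃′ ∃′ (#1 ∈′ #3 ∧′ orderedPair #2 #1 #0)) (c ∷ []) S)

  ∈-restrict : ∀ {S c p} → p ∈ restrict S c ⇔ (p ∈ S × ∃[ c′ ] ∃[ e ] c′ ∈ c × p ≡ ⟨ c′ , e ⟩)
  ∈-restrict {S} {c} {p} = mk⇔
    (λ q → let p∈S , c′ , e , c′∈c , eq = to spec q in p∈S , c′ , e , c′∈c , to ⊨orderedPair eq)
    (λ (p∈S , c′ , e , c′∈c , eq) → from spec (p∈S , c′ , e , c′∈c , from ⊨orderedPair eq))
    where
    spec : p ∈ restrict S c ⇔ (p ∈ S × N ⊨ ∃′ ∃′ (#1 ∈′ #3 ∧′ orderedPair #2 #1 #0) [ p ∷ c ∷ [] ])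
    spec = proj₂ (comprehension (∃′ ∃′ (#1 ∈′ #3 ∧′ orderedPair #2 #1 #0)) (c ∷ []) S) p

  ⟨,⟩∈restrict : ∀ {S c c′ e} → ⟨ c′ , e ⟩ ∈ restrict S c ⇔ (⟨ c′ , e ⟩ ∈ S × c′ ∈ c)
  ⟨,⟩∈restrict {S} {c} {c′} {e} = mk⇔ there λ (p , q) → from ∈-restrict (p , _ , _ , q , refl)
    where
    there : ⟨ c′ , e ⟩ ∈ restrict S c → ⟨ c′ , e ⟩ ∈ S × c′ ∈ c
    there p with to ∈-restrict p
    ... | q , _ , _ , r , eq with ⟨,⟩-injective eq
    ... | refl , _ = q , r

  -- In `recursion` this shows that extending a relation at later codes leaves the clause for an
  -- earlier code unchanged.
  restrict-cong : ∀ {S S′ c} → (∀ c′ e → c′ ∈ c → ⟨ c′ , e ⟩ ∈ S ⇔ ⟨ c′ , e ⟩ ∈ S′) →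
                  restrict S c ≡ restrict S′ c
  restrict-cong h = extensional λ p → mk⇔
    (λ q → let p∈S , c′ , e , c′∈c , eq = to ∈-restrict q in
           from ∈-restrict (transport eq (to (h c′ e c′∈c)) p∈S , c′ , e , c′∈c , eq))
    (λ q → let p∈S , c′ , e , c′∈c , eq = to ∈-restrict q in
           from ∈-restrict (transport eq (from (h c′ e c′∈c)) p∈S , c′ , e , c′∈c , eq))
    where
    transport : ∀ {p q S S′ : V} → p ≡ q → (q ∈ S → q ∈ S′) → p ∈ S → p ∈ S′
    transport refl f = f

  ⊨restriction : ∀ {R S c} → (N ⊨ restriction #0 #1 #2 [ R ∷ S ∷ c ∷ [] ]) ⇔ R ≡ restrict S c
  ⊨restriction {R} {S} {c} = mk⇔ there back
    where
    there : N ⊨ restriction #0 #1 #2 [ R ∷ S ∷ c ∷ [] ] → R ≡ restrict S c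
    there h = extensional λ p → mk⇔
      (λ p∈R → let p∈S , c′ , e , q , r = proj₁ (h p) p∈R in
               from ∈-restrict (p∈S , c′ , e , q , to ⊨orderedPair r))
      (λ p∈ → let p∈S , c′ , e , q , r = to ∈-restrict p∈ in
              proj₂ (h p) (p∈S , c′ , e , q , from ⊨orderedPair r))
    back : R ≡ restrict S c → N ⊨ restriction #0 #1 #2 [ R ∷ S ∷ c ∷ [] ]
    back refl p =
        (λ p∈ → let p∈S , c′ , e , q , r = to ∈-restrict p∈ in
                p∈S , c′ , e , q , from ⊨orderedPair r)
      , (λ (p∈S , c′ , e , q , r) → from ∈-restrict (p∈S , c′ , e , q , to ⊨orderedPair r))

  -- External induction on `i`: each step adds the pairs with first component `num i` that `φ`
  -- dictates, given the relation so far. Only standard lengths are built here; overspill goes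
  -- beyond them.
  recursion : (φ : Formula (3 + n)) (q : Vec V n) (A : V) (i : ℕ) →
              ∃[ S ] ∀ {c e} → c ∈ num i → e ∈ A →
                ⟨ c , e ⟩ ∈ S ⇔ (N ⊨ φ [ restrict S c ∷ c ∷ e ∷ q ])
  recursion φ q A zero    = ∅ , λ p → ⊥-elim (∉∅ p)
  recursion φ q A (suc i) with recursion φ q A i
  ... | S , S-spec = S′ , S′-spec
    where
    c₀ : V
    c₀ = num i
    ψ : Formula _
    ψ = ∃′ (#0 ∈′ #4 ∧′ orderedPair #1 #2 #0 ∧′ rename (#3 ◂ #2 ◂ #0 ◂ (5 ↑ʳ_)) φ)
    new : ∃[ X ] ∀ p → p ∈ X ⇔ (p ∈ 𝒫 (𝒫 (｛ c₀ ｝ ∪ A)) × N ⊨ ψ [ p ∷ c₀ ∷ restrict S c₀ ∷ A ∷ q ])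
    -- The double power set contains all pairs `⟨ c₀ , e ⟩` with `e ∈ A` and so provides the bound
    -- for separation.
    new = comprehension ψ (c₀ ∷ restrict S c₀ ∷ A ∷ q) (𝒫 (𝒫 (｛ c₀ ｝ ∪ A)))
    S′ : V
    -- The specification of `S` says nothing about pairs whose first component is `c₀`. Restricting
    -- discards any such pair, so that only `new` decides what happens at `c₀`.
    S′ = restrict S c₀ ∪ proj₁ new
    renamed : ∀ e p → (N ⊨ rename (#3 ◂ #2 ◂ #0 ◂ (5 ↑ʳ_)) φ
                         [ e ∷ p ∷ c₀ ∷ restrict S c₀ ∷ A ∷ q ]) ⇔
                      (N ⊨ φ [ restrict S c₀ ∷ c₀ ∷ e ∷ q ])
    renamed e p = ⊨-rename _ φ
      λ { zero → refl ; (suc zero) → refl ; (suc (suc zero)) → refl ; (suc (suc (suc j))) → refl }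
    old⇔ : ∀ {c e} → c ∈ c₀ → ⟨ c , e ⟩ ∈ S ⇔ ⟨ c , e ⟩ ∈ S′
    old⇔ {c} {e} c∈ = mk⇔ (λ p → from ∈-∪ (inj₁ (from ⟨,⟩∈restrict (p , c∈)))) there
      where
      there : ⟨ c , e ⟩ ∈ S′ → ⟨ c , e ⟩ ∈ S
      there p with to ∈-∪ p
      ... | inj₁ q = proj₁ (to ⟨,⟩∈restrict q)
      ... | inj₂ q with proj₂ (to (proj₂ new _) q)
      ... | _ , _ , eq , _ with ⟨,⟩-injective (to ⊨orderedPair eq)
      ... | refl , _ = ⊥-elim (∉-self c∈)
    new⇔ : ∀ {e} → e ∈ A → (N ⊨ φ [ restrict S c₀ ∷ c₀ ∷ e ∷ q ]) ⇔ ⟨ c₀ , e ⟩ ∈ S′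
    new⇔ {e} e∈A = mk⇔
      (λ p → from ∈-∪ (inj₂ (from (proj₂ new _)
        ( ⟨,⟩∈𝒫𝒫 (from ∈-∪ (inj₁ (from ∈-singleton refl))) (from ∈-∪ (inj₂ e∈A))
        , e , e∈A , from ⊨orderedPair refl , from (renamed e _) p))))
      there
      where
      there : ⟨ c₀ , e ⟩ ∈ S′ → N ⊨ φ [ restrict S c₀ ∷ c₀ ∷ e ∷ q ]
      there p with to ∈-∪ p
      ... | inj₁ q = ⊥-elim (∉-self (proj₂ (to ⟨,⟩∈restrict q)))
      ... | inj₂ q with proj₂ (to (proj₂ new _) q)
      ... | e′ , _ , eq , r with ⟨,⟩-injective (to ⊨orderedPair eq)
      ... | _ , refl = to (renamed e _) r
    num-transitive : ∀ {c c′} → c ∈ c₀ → c′ ∈ c → c′ ∈ c₀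
    num-transitive c∈ c′∈ with to (∈-num i) c∈
    ... | j , j<i , refl with to (∈-num j) c′∈
    ... | k , k<j , refl = num-mono (ℕ.<-trans k<j j<i)
    S′-spec : ∀ {c e} → c ∈ num (suc i) → e ∈ A →
              ⟨ c , e ⟩ ∈ S′ ⇔ (N ⊨ φ [ restrict S′ c ∷ c ∷ e ∷ q ])
    S′-spec {c} {e} c∈ e∈A with to ∈-S⁺ c∈
    ... | inj₁ c∈c₀ = subst (λ R → ⟨ c , e ⟩ ∈ S′ ⇔ (N ⊨ φ [ R ∷ c ∷ e ∷ q ]))
      (restrict-cong λ c′ e′ c′∈c → old⇔ (num-transitive c∈c₀ c′∈c))
      (S-spec c∈c₀ e∈A ⇔-∘ ⇔-sym (old⇔ c∈c₀))
    ... | inj₂ refl = subst (λ R → ⟨ c , e ⟩ ∈ S′ ⇔ (N ⊨ φ [ R ∷ c ∷ e ∷ q ]))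
      (restrict-cong λ c′ e′ c′∈c → old⇔ c′∈c)
      (⇔-sym (new⇔ e∈A))

-- A structure `M` that is a set in `N`.

module SetModel (M N : Structure ℓ) (zfc : N ⊨ZFC)
                {m E : Structure.Carrier N} (M-in-N : IsSetIn M N m E) where
  open Structure M using () renaming (Carrier to U; _∈_ to _∈ᴹ_)
  open Structure N using (_∈_) renaming (Carrier to V)
  open Semantics N
  open SetTheory N zfc
  open IsSetIn M-in-N using (embed; injective; range; preserves)

  embed∈ : ∀ x → embed x ∈ m
  embed∈ x = from (range (embed x)) (x , refl)

  ∈-embed : ∀ {x y} → ⟨ embed x , embed y ⟩ ∈ E ⇔ x ∈ᴹ y
  ∈-embed {x} {y} = ⇔-sym (⊨related {embed x} {E} {embed y} ⇔-∘ preserves x y)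

  -- Relativization needs variables for the domain and the relation, and `ρ` makes room for them. A
  -- quantifier bounded by `m` ranges exactly over the values of `embed`.
  ⊨-relativize : (ρ : Fin k → Fin n) (φ : Formula k) {m′ E′ : Fin n} {d : Vec V n} {e : Vec U k} →
                 lookup d m′ ≡ m → lookup d E′ ≡ E →
                 (∀ i → lookup d (ρ i) ≡ embed (lookup e i)) →
                 (N ⊨ rename ρ φ ^⟨ m′ , E′ ⟩ [ d ]) ⇔ (M ⊨ φ [ e ])
  ⊨-relativize-lift :
    (ρ : Fin k → Fin n) (φ : Formula (suc k)) {m′ E′ : Fin n} {d : Vec V n} {e : Vec U k} →
    lookup d m′ ≡ m → lookup d E′ ≡ E → (∀ i → lookup d (ρ i) ≡ embed (lookup e i)) → ∀ a →
    (N ⊨ rename (lift 1 ρ) φ ^⟨ suc m′ , suc E′ ⟩ [ embed a ∷ d ]) ⇔ (M ⊨ φ [ a ∷ e ])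

  ⊨-relativize ρ (x ∈′ y) {m′} {E′} {d} {e} hm hE h =
    ∈-embed ⇔-∘ (mk⇔ (subst id eq) (subst id (sym eq)) ⇔-∘
      ⊨related {lookup d (ρ x)} {lookup d E′} {lookup d (ρ y)})
    where
    eq : (⟨ lookup d (ρ x) , lookup d (ρ y) ⟩ ∈ lookup d E′) ≡
         (⟨ embed (lookup e x) , embed (lookup e y) ⟩ ∈ E)
    eq = cong₂ _∈_ (cong₂ ⟨_,_⟩ (h x) (h y)) hE
  ⊨-relativize ρ (x ≐ y) hm hE h = mk⇔
    (λ p → injective (trans (sym (h x)) (trans p (h y))))
    (λ p → trans (h x) (trans (cong embed p) (sym (h y))))
  ⊨-relativize ρ ⊥′ hm hE h = mk⇔ id id
  ⊨-relativize ρ (φ ⇒′ ψ) hm hE h = mk⇔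
    (λ f → to (⊨-relativize ρ ψ hm hE h) ∘ f ∘ from (⊨-relativize ρ φ hm hE h))
    (λ f → from (⊨-relativize ρ ψ hm hE h) ∘ f ∘ to (⊨-relativize ρ φ hm hE h))
  ⊨-relativize ρ (φ ∧′ ψ) hm hE h = mk⇔
    (λ (p , q) → to (⊨-relativize ρ φ hm hE h) p , to (⊨-relativize ρ ψ hm hE h) q)
    (λ (p , q) → from (⊨-relativize ρ φ hm hE h) p , from (⊨-relativize ρ ψ hm hE h) q)
  ⊨-relativize ρ (φ ∨′ ψ) hm hE h = mk⇔
    [ inj₁ ∘ to (⊨-relativize ρ φ hm hE h) , inj₂ ∘ to (⊨-relativize ρ ψ hm hE h) ]′
    [ inj₁ ∘ from (⊨-relativize ρ φ hm hE h) , inj₂ ∘ from (⊨-relativize ρ ψ hm hE h) ]′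
  ⊨-relativize {k} {n} ρ (∀′ φ) {m′} {E′} {d} {e} hm hE h = mk⇔
    (λ f a → to (⊨-relativize-lift ρ φ hm hE h a)
               (f (embed a) (subst (embed a ∈_) (sym hm) (embed∈ a))))
    back
    where
    back : M ⊨ ∀′ φ [ e ] → N ⊨ rename ρ (∀′ φ) ^⟨ m′ , E′ ⟩ [ d ]
    back f v v∈m with to (range v) (subst (v ∈_) hm v∈m)
    ... | a , refl = from (⊨-relativize-lift ρ φ hm hE h a) (f a)
  ⊨-relativize ρ (∃′ φ) {m′} {E′} {d} {e} hm hE h = mk⇔ there
    λ (a , p) → embed a , subst (embed a ∈_) (sym hm) (embed∈ a)
              , from (⊨-relativize-lift ρ φ hm hE h a) p
    where
    there : N ⊨ rename ρ (∃′ φ) ^⟨ m′ , E′ ⟩ [ d ] → M ⊨ ∃′ φ [ e ]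
    there (v , v∈m , p) with to (range v) (subst (v ∈_) hm v∈m)
    ... | a , refl = a , to (⊨-relativize-lift ρ φ hm hE h a) p

  ⊨-relativize-lift ρ φ hm hE h a =
    ⊨-relativize (lift 1 ρ) φ hm hE λ { zero → refl ; (suc i) → h i }

  -- Assignments as sets of `N`.

  entry : Vec U n → Fin n → V
  entry e i = ⟨ num (toℕ i) , embed (lookup e i) ⟩

  abstract
    -- A tuple has standard length, so its graph, with numerals as indices, is a finite set that `N`
    -- contains.
    rep : Vec U n → V
    rep e = finiteSet (entry e)

    ∈-rep : (e : Vec U n) {p : V} → p ∈ rep e ⇔ (∃[ i ] p ≡ entry e i)
    ∈-rep {n} e = ∈-finiteSet {n} {entry e}

  ⟨,⟩∈rep : (e : Vec U n) (i : Fin n) {v : V} → ⟨ num (toℕ i) , v ⟩ ∈ rep e ⇔ v ≡ embed (lookup e i)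
  ⟨,⟩∈rep e i {v} = mk⇔ there λ { refl → from (∈-rep e) (i , refl) }
    where
    there : ⟨ num (toℕ i) , v ⟩ ∈ rep e → v ≡ embed (lookup e i)
    there p with to (∈-rep e) p
    ... | j , eq with ⟨,⟩-injective eq
    ... | eq₁ , eq₂ with Fin.toℕ-injective {i = i} {j} (num-injective eq₁)
    ... | refl = eq₂

  -- The new entry is an element of `m`, hence some `embed a`. Quantifying over extended assignments
  -- in `N` is thus quantifying over `M`.
  ⊨prepended : ∀ {e′} {e : Vec U n} →
               (N ⊨ prepended #0 #1 #2 [ e′ ∷ rep e ∷ m ∷ [] ]) ⇔ (∃[ a ] e′ ≡ rep (a ∷ e))
  ⊨prepended {n} {e′} {e} = mk⇔ there back
    where
    shifted : V → V → Set _
    shifted a p = (∃[ z ] (N ⊨ empty #0 [ z ∷ [] ]) × (N ⊨ orderedPair #0 #1 #2 [ p ∷ z ∷ a ∷ [] ]))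
        ⊎ (∃[ v ] ∃[ j ] ∃[ i ] (N ⊨ related #0 #1 #2 [ i ∷ rep e ∷ v ∷ [] ])
            × (N ⊨ successor #0 #1 [ j ∷ i ∷ [] ]) × (N ⊨ orderedPair #0 #1 #2 [ p ∷ j ∷ v ∷ [] ]))
    shifted⇔ : ∀ a p → shifted (embed a) p ⇔ p ∈ rep (a ∷ e)
    shifted⇔ a p = mk⇔ f (g ∘ to (∈-rep (a ∷ e)))
      where
      f : shifted (embed a) p → p ∈ rep (a ∷ e)
      f (inj₁ (z , z-empty , q)) with to ⊨empty z-empty
      ... | refl = from (∈-rep (a ∷ e)) (zero , to ⊨orderedPair q)
      f (inj₂ (v , j , i , q , r , s)) with to (∈-rep e) (to ⊨related q)
      ... | x , eq with ⟨,⟩-injective eq | to ⊨successor r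
      ... | refl , refl | refl = from (∈-rep (a ∷ e)) (suc x , to ⊨orderedPair s)
      g : (∃[ i ] p ≡ entry (a ∷ e) i) → shifted (embed a) p
      g (zero  , eq) = inj₁ (∅ , from ⊨empty refl , from ⊨orderedPair eq)
      g (suc i , eq) = inj₂ (embed (lookup e i) , num (suc (toℕ i)) , num (toℕ i)
                            , from ⊨related (from (⟨,⟩∈rep e i) refl)
                            , from ⊨successor refl , from ⊨orderedPair eq)
    there : N ⊨ prepended #0 #1 #2 [ e′ ∷ rep e ∷ m ∷ [] ] → ∃[ a ] e′ ≡ rep (a ∷ e)
    there (v , v∈m , h) with to (range v) v∈m
    ... | a , refl = a , extensional λ p → shifted⇔ a p ⇔-∘ ×⇒⇔ (h p)
    back : (∃[ a ] e′ ≡ rep (a ∷ e)) → N ⊨ prepended #0 #1 #2 [ e′ ∷ rep e ∷ m ∷ [] ]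
    back (a , refl) = embed a , embed∈ a , λ p → ⇔⇒× (⇔-sym (shifted⇔ a p))

  -- One set large enough for tuples of every length; it also has elements that are not sequences.
  assignments : V
  assignments = 𝒫 (𝒫 (𝒫 (proj₁ infinite ∪ m)))

  rep∈assignments : (e : Vec U n) → rep e ∈ assignments
  rep∈assignments e = from ∈-𝒫 λ p p∈ → sub (to (∈-rep e) p∈)
    where
    sub : ∀ {p} → (∃[ i ] p ≡ entry e i) → p ∈ 𝒫 (𝒫 (proj₁ infinite ∪ m))
    sub (i , refl) = ⟨,⟩∈𝒫𝒫
      (from ∈-∪ (inj₁ (Inductive.num∈ (proj₂ infinite) (toℕ i))))
      (from ∈-∪ (inj₂ (embed∈ (lookup e i))))

  -- Satisfaction classes and their agreement with truth in `M`.

  SatisfactionClass : V → V → Set ℓ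
  SatisfactionClass S d = ∀ {c e} → c ∈ d → e ∈ assignments →
    ⟨ c , e ⟩ ∈ S ⇔ (N ⊨ tarski [ restrict S c ∷ c ∷ e ∷ m ∷ E ∷ [] ])

  opaque
    unfolding satisfactionClass

    ⊨satisfactionClass :
      ∀ {S d} → (N ⊨ satisfactionClass [ S ∷ d ∷ assignments ∷ m ∷ E ∷ [] ]) ⇔ SatisfactionClass S d
    ⊨satisfactionClass {S} {d} = mk⇔
      (λ h {c} {e} c∈d e∈A → clause⇔ c e ⇔-∘ (×⇒⇔ (h c c∈d e e∈A) ⇔-∘ ⇔-sym ⊨related))
      (λ h c c∈d e e∈A → ⇔⇒× (⇔-sym (clause⇔ c e) ⇔-∘ (h c∈d e∈A ⇔-∘ ⊨related)))
      where
      env : V → V → V → Vec V 8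
      env R e c = R ∷ e ∷ c ∷ S ∷ d ∷ assignments ∷ m ∷ E ∷ []
      renamed : ∀ R e c → (N ⊨ rename (#0 ◂ #2 ◂ #1 ◂ (6 ↑ʳ_)) tarski [ env R e c ]) ⇔
                          (N ⊨ tarski [ R ∷ c ∷ e ∷ m ∷ E ∷ [] ])
      renamed R e c = ⊨-rename _ tarski
        λ { zero → refl ; (suc zero) → refl ; (suc (suc zero)) → refl ; (suc (suc (suc j))) → refl }
      clause : V → V → Set ℓ
      clause c e = ∃[ R ] (N ⊨ restriction #0 #1 #2 [ R ∷ S ∷ c ∷ [] ])
                        × (N ⊨ rename (#0 ◂ #2 ◂ #1 ◂ (6 ↑ʳ_)) tarski [ env R e c ])
      clause⇔ : ∀ c e → clause c e ⇔ (N ⊨ tarski [ restrict S c ∷ c ∷ e ∷ m ∷ E ∷ [] ])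
      clause⇔ c e = mk⇔ there
        (λ p → restrict S c , from ⊨restriction refl , from (renamed (restrict S c) e c) p)
        where
        there : clause c e → N ⊨ tarski [ restrict S c ∷ c ∷ e ∷ m ∷ E ∷ [] ]
        there (R , p , q) with to ⊨restriction p
        ... | refl = to (renamed R e c) q

  -- The components found by `N` are elements of a standard numeral, hence standard;
  -- representability and injectivity of pairing identify them with `x` and `y`.
  ⊨split : (χ : Formula 7) (x y : ℕ) {R e : V} →
           (N ⊨ split χ [ R ∷ num ⟪ x , y ⟫ ∷ e ∷ m ∷ E ∷ [] ]) ⇔
           (N ⊨ χ [ num y ∷ num x ∷ R ∷ num ⟪ x , y ⟫ ∷ e ∷ m ∷ E ∷ [] ])
  ⊨split χ x y {R} {e} = mk⇔ there
    λ p → num x , num y , num-mono (⟪,⟫-<ʳ x y) , num-mono (⟪,⟫-<ˡ x y)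
        , from (renamed (num y) (num x)) (from (coded x y) refl) , p
    where
    b : V
    b = num ⟪ x , y ⟫
    renamed : ∀ v u → (N ⊨ rename (#3 ◂ #1 ◂ #0 ◂ λ ()) (graph pairing-function)
                         [ v ∷ u ∷ R ∷ b ∷ e ∷ m ∷ E ∷ [] ]) ⇔
                      (N ⊨ graph pairing-function [ b ∷ u ∷ v ∷ [] ])
    renamed v u = ⊨-rename _ (graph pairing-function)
      λ { zero → refl ; (suc zero) → refl ; (suc (suc zero)) → refl }
    coded : ∀ i j → (N ⊨ graph pairing-function [ b ∷ num i ∷ num j ∷ [] ]) ⇔ b ≡ num ⟪ i , j ⟫
    coded i j = Represents.⊨graph (graph-represents (pairing-function⇓ i j)) b
    there : N ⊨ split χ [ R ∷ b ∷ e ∷ m ∷ E ∷ [] ] →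
            N ⊨ χ [ num y ∷ num x ∷ R ∷ b ∷ e ∷ m ∷ E ∷ [] ]
    there (u , v , v∈ , u∈ , p , q) with to (∈-num ⟪ x , y ⟫) v∈ | to (∈-num ⟪ x , y ⟫) u∈
    ... | j , _ , refl | i , _ , refl
      with ⟪,⟫-injective x y i j (num-injective (to (coded i j) (to (renamed (num j) (num i)) p)))
    ... | refl , refl = q

  opaque
    unfolding tarski

    ⊨tarski-⋁ : ∀ {e} → (N ⊨ tarski [ e ]) ⇔ (∃[ t ] N ⊨ tarskiFor t [ e ])
    ⊨tarski-⋁ = ⊨-⋁ tarskiFor

  -- By the same argument a standard code determines its tag and its remainder, so just one disjunct
  -- can apply.
  ⊨tarski : (t : Fin 8) (b : ℕ) {R e : V} →
            (N ⊨ tarski [ R ∷ num ⟪ toℕ t , b ⟫ ∷ e ∷ m ∷ E ∷ [] ]) ⇔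
            (N ⊨ lookup clauses t [ R ∷ num b ∷ e ∷ m ∷ E ∷ [] ])
  ⊨tarski t b {R} {e} = mk⇔ (there ∘ to ⊨tarski-⋁) λ p → from ⊨tarski-⋁
    (t , num b , num-mono (⟪,⟫-<ʳ (toℕ t) b) , from (renamed t (num b)) (from (coded t b) refl)
    , from (renamed′ t (num b)) p)
    where
    c : V
    c = num ⟪ toℕ t , b ⟫
    env : Vec V 5
    env = R ∷ c ∷ e ∷ m ∷ E ∷ []
    renamed : ∀ s v → (N ⊨ rename (#2 ◂ #0 ◂ λ ()) (graph (tagged (toℕ s))) [ v ∷ env ]) ⇔
                      (N ⊨ graph (tagged (toℕ s)) [ c ∷ v ∷ [] ])
    renamed s v = ⊨-rename _ (graph (tagged (toℕ s))) λ { zero → refl ; (suc zero) → refl }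
    renamed′ : ∀ s v → (N ⊨ rename (#1 ◂ #0 ◂ (3 ↑ʳ_)) (lookup clauses s) [ v ∷ env ]) ⇔
                       (N ⊨ lookup clauses s [ R ∷ v ∷ e ∷ m ∷ E ∷ [] ])
    renamed′ s v = ⊨-rename _ (lookup clauses s)
      λ { zero → refl ; (suc zero) → refl ; (suc (suc j)) → refl }
    coded : ∀ s j → (N ⊨ graph (tagged (toℕ s)) [ c ∷ num j ∷ [] ]) ⇔ c ≡ num ⟪ toℕ s , j ⟫
    coded s j = Represents.⊨graph (graph-represents (tagged⇓ (toℕ s) j)) c
    there : (∃[ s ] N ⊨ tarskiFor s [ env ]) → N ⊨ lookup clauses t [ R ∷ num b ∷ e ∷ m ∷ E ∷ [] ]
    there (s , v , v∈c , p , q) with to (∈-num ⟪ toℕ t , b ⟫) v∈c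
    ... | j , _ , refl
      with ⟪,⟫-injective (toℕ t) b (toℕ s) j
             (num-injective (to (coded s j) (to (renamed s (num j)) p)))
    ... | eq , refl with Fin.toℕ-injective eq
    ... | refl = to (renamed′ t (num b)) q

  module _ {S d : V} (S-class : SatisfactionClass S d) where

    S⇔clause : (t : Fin 8) (b : ℕ) → num ⟪ toℕ t , b ⟫ ∈ d → (e : Vec U n) →
               ⟨ num ⟪ toℕ t , b ⟫ , rep e ⟩ ∈ S ⇔
               (N ⊨ lookup clauses t
                  [ restrict S (num ⟪ toℕ t , b ⟫) ∷ num b ∷ rep e ∷ m ∷ E ∷ [] ])
    S⇔clause t b c∈d e = ⊨tarski t b ⇔-∘ S-class c∈d (rep∈assignments e)

    -- Recursion on the actual formula, whose subformulas have smaller standard codes. The condition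
    -- on `d` mentions actual numbers only, so it fits a standard `d` beyond the code as well as the
    -- nonstandard one that overspill yields.
    satisfies : (φ : Formula n) → (∀ i → i ≤ code φ → num i ∈ d) → (e : Vec U n) →
                ⟨ num (code φ) , rep e ⟩ ∈ S ⇔ (M ⊨ φ [ e ])
    -- The form in which subformulas occur in the clause for `c`.
    satisfiesᴿ : (φ : Formula n) {c : ℕ} → code φ < c → (∀ i → i ≤ c → num i ∈ d) → (e : Vec U n) →
                 (N ⊨ related #0 #1 #2 [ num (code φ) ∷ restrict S (num c) ∷ rep e ∷ [] ]) ⇔
                 (M ⊨ φ [ e ])

    satisfiesᴿ φ {c} φ<c below e =
      satisfies φ (λ i i≤φ → below i (ℕ.≤-trans i≤φ (ℕ.<⇒≤ φ<c))) e ⇔-∘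
        (mk⇔ proj₁ (λ p → p , num-mono φ<c) ⇔-∘ (⟨,⟩∈restrict ⇔-∘ ⊨related))

    satisfies (x ∈′ y) below e =
      mk⇔ there back ⇔-∘
        (⊨split (∃′ ∃′ (related #3 #6 #1 ∧′ related #2 #6 #0 ∧′ related #1 #8 #0))
          (toℕ x) (toℕ y) ⇔-∘
          S⇔clause #0 ⟪ toℕ x , toℕ y ⟫ (below _ ℕ.≤-refl) e)
      where
      Clause : Set _
      Clause = ∃[ u ] ∃[ v ] (N ⊨ related #0 #1 #2 [ num (toℕ x) ∷ rep e ∷ u ∷ [] ])
                           × (N ⊨ related #0 #1 #2 [ num (toℕ y) ∷ rep e ∷ v ∷ [] ])
                           × (N ⊨ related #0 #1 #2 [ u ∷ E ∷ v ∷ [] ])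
      there : Clause → lookup e x ∈ᴹ lookup e y
      there (u , v , p , q , r)
        with to (⟨,⟩∈rep e x) (to ⊨related p) | to (⟨,⟩∈rep e y) (to ⊨related q)
      ... | refl | refl = to ∈-embed (to ⊨related r)
      back : lookup e x ∈ᴹ lookup e y → Clause
      back p = embed (lookup e x) , embed (lookup e y)
        , from ⊨related (from (⟨,⟩∈rep e x) refl)
        , from ⊨related (from (⟨,⟩∈rep e y) refl) , from ⊨related (from ∈-embed p)
    satisfies (x ≐ y) below e =
      mk⇔ there back ⇔-∘
        (⊨split (∃′ (related #2 #5 #0 ∧′ related #1 #5 #0)) (toℕ x) (toℕ y) ⇔-∘
          S⇔clause #1 ⟪ toℕ x , toℕ y ⟫ (below _ ℕ.≤-refl) e)
      where
      Clause : Set _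
      Clause = ∃[ u ] (N ⊨ related #0 #1 #2 [ num (toℕ x) ∷ rep e ∷ u ∷ [] ])
                    × (N ⊨ related #0 #1 #2 [ num (toℕ y) ∷ rep e ∷ u ∷ [] ])
      there : Clause → lookup e x ≡ lookup e y
      there (u , p , q) = injective (trans (sym (to (⟨,⟩∈rep e x) (to ⊨related p)))
                                           (to (⟨,⟩∈rep e y) (to ⊨related q)))
      back : lookup e x ≡ lookup e y → Clause
      back eq = embed (lookup e x) , from ⊨related (from (⟨,⟩∈rep e x) refl)
              , from ⊨related (from (⟨,⟩∈rep e y) (cong embed eq))
    satisfies ⊥′ below e = S⇔clause #2 0 (below _ ℕ.≤-refl) e
    satisfies (φ ⇒′ ψ) below e =
      mk⇔ (λ h → to ψ⇔ ∘ h ∘ from φ⇔) (λ h → from ψ⇔ ∘ h ∘ to φ⇔) ⇔-∘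
        (⊨split (related #1 #2 #4 ⇒′ related #0 #2 #4) (code φ) (code ψ) ⇔-∘
          S⇔clause #3 ⟪ code φ , code ψ ⟫ (below _ ℕ.≤-refl) e)
      where
      φ⇔ = satisfiesᴿ φ (ℕ.<-trans (⟪,⟫-<ˡ (code φ) (code ψ)) (⟪,⟫-<ʳ 3 _)) below e
      ψ⇔ = satisfiesᴿ ψ (ℕ.<-trans (⟪,⟫-<ʳ (code φ) (code ψ)) (⟪,⟫-<ʳ 3 _)) below e
    satisfies (φ ∧′ ψ) below e =
      mk⇔ (λ (p , q) → to φ⇔ p , to ψ⇔ q) (λ (p , q) → from φ⇔ p , from ψ⇔ q) ⇔-∘
        (⊨split (related #1 #2 #4 ∧′ related #0 #2 #4) (code φ) (code ψ) ⇔-∘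
          S⇔clause #4 ⟪ code φ , code ψ ⟫ (below _ ℕ.≤-refl) e)
      where
      φ⇔ = satisfiesᴿ φ (ℕ.<-trans (⟪,⟫-<ˡ (code φ) (code ψ)) (⟪,⟫-<ʳ 4 _)) below e
      ψ⇔ = satisfiesᴿ ψ (ℕ.<-trans (⟪,⟫-<ʳ (code φ) (code ψ)) (⟪,⟫-<ʳ 4 _)) below e
    satisfies (φ ∨′ ψ) below e =
      mk⇔ [ inj₁ ∘ to φ⇔ , inj₂ ∘ to ψ⇔ ]′ [ inj₁ ∘ from φ⇔ , inj₂ ∘ from ψ⇔ ]′ ⇔-∘
        (⊨split (related #1 #2 #4 ∨′ related #0 #2 #4) (code φ) (code ψ) ⇔-∘
          S⇔clause #5 ⟪ code φ , code ψ ⟫ (below _ ℕ.≤-refl) e)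
      where
      φ⇔ = satisfiesᴿ φ (ℕ.<-trans (⟪,⟫-<ˡ (code φ) (code ψ)) (⟪,⟫-<ʳ 5 _)) below e
      ψ⇔ = satisfiesᴿ ψ (ℕ.<-trans (⟪,⟫-<ʳ (code φ) (code ψ)) (⟪,⟫-<ʳ 5 _)) below e
    satisfies (∀′ φ) below e =
      mk⇔ (λ h a → to (φ⇔ a) (h (rep (a ∷ e)) (from (⊨prepended {e = e}) (a , refl)))) back ⇔-∘
        S⇔clause #6 (code φ) (below _ ℕ.≤-refl) e
      where
      φ⇔ : ∀ a → _ ⇔ (M ⊨ φ [ a ∷ e ])
      φ⇔ a = satisfiesᴿ φ (⟪,⟫-<ʳ 6 (code φ)) below (a ∷ e)
      back : M ⊨ ∀′ φ [ e ] →
             ∀ e′ → N ⊨ prepended #0 #1 #2 [ e′ ∷ rep e ∷ m ∷ [] ] →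
             N ⊨ related #0 #1 #2 [ num (code φ) ∷ restrict S (num (code (∀′ φ))) ∷ e′ ∷ [] ]
      back h e′ p with to (⊨prepended {e = e}) p
      ... | a , refl = from (φ⇔ a) (h a)
    satisfies (∃′ φ) below e =
      mk⇔ there (λ (a , p) → rep (a ∷ e) , from (⊨prepended {e = e}) (a , refl) , from (φ⇔ a) p) ⇔-∘
        S⇔clause #7 (code φ) (below _ ℕ.≤-refl) e
      where
      φ⇔ : ∀ a → _ ⇔ (M ⊨ φ [ a ∷ e ])
      φ⇔ a = satisfiesᴿ φ (⟪,⟫-<ʳ 7 (code φ)) below (a ∷ e)
      there : (∃[ e′ ] (N ⊨ prepended #0 #1 #2 [ e′ ∷ rep e ∷ m ∷ [] ]) ×
               (N ⊨ related #0 #1 #2 [ num (code φ) ∷ restrict S (num (code (∃′ φ))) ∷ e′ ∷ [] ])) →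
              M ⊨ ∃′ φ [ e ]
      there (e′ , p , q) with to (⊨prepended {e = e}) p
      ... | a , refl = a , to (φ⇔ a) q

  -- Tuples of `M` recovered from sequences in `N`.

  ⊨sequence : ∀ {e n} → (N ⊨ sequence #0 #1 #2 [ e ∷ num n ∷ m ∷ [] ]) ⇔
                        (Σ[ x̄ ∈ Vec U n ] e ≡ rep x̄)
  ⊨sequence {e} {n} = mk⇔ there back
    where
    there : N ⊨ sequence #0 #1 #2 [ e ∷ num n ∷ m ∷ [] ] → Σ[ x̄ ∈ Vec U n ] e ≡ rep x̄
    there (h , values) = tabulate x , extensional λ p → mk⇔ (f p) (g p)
      where
      at : (i : Fin n) → ∃[ v ] v ∈ m × (∀ u → (⟨ num (toℕ i) , u ⟩ ∈ e) ⇔ u ≡ v)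
      at i with values (num (toℕ i)) (num-mono (Fin.toℕ<n i))
      ... | v , v∈m , p = v , v∈m , λ u → ×⇒⇔ (p u) ⇔-∘ ⇔-sym ⊨related
      x : Fin n → U
      x i = proj₁ (to (range _) (proj₁ (proj₂ (at i))))
      embed-x : ∀ i → embed (lookup (tabulate x) i) ≡ proj₁ (at i)
      embed-x i = trans (cong embed (lookup∘tabulate x i))
                        (proj₂ (to (range _) (proj₁ (proj₂ (at i)))))
      f : ∀ p → p ∈ e → p ∈ rep (tabulate x)
      f p p∈e with h p p∈e
      ... | i , v , i∈n , eq with to ⊨orderedPair eq | to (∈-num n) i∈n
      ... | refl | j , j<n , refl = subst (λ i → ⟨ num i , v ⟩ ∈ rep (tabulate x))
        (Fin.toℕ-fromℕ< j<n)
        (from (⟨,⟩∈rep (tabulate x) (fromℕ< j<n)) (trans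
          (to (proj₂ (proj₂ (at (fromℕ< j<n))) v)
            (subst (λ i → ⟨ num i , v ⟩ ∈ e) (sym (Fin.toℕ-fromℕ< j<n)) p∈e))
          (sym (embed-x (fromℕ< j<n)))))
      g : ∀ p → p ∈ rep (tabulate x) → p ∈ e
      g p p∈ with to (∈-rep (tabulate x)) p∈
      ... | i , refl = from (proj₂ (proj₂ (at i)) _) (embed-x i)
    back : (Σ[ x̄ ∈ Vec U n ] e ≡ rep x̄) → N ⊨ sequence #0 #1 #2 [ e ∷ num n ∷ m ∷ [] ]
    back (x̄ , refl) = pairs , values
      where
      pairs : ∀ p → p ∈ rep x̄ →
              ∃[ i ] ∃[ v ] i ∈ num n × (N ⊨ orderedPair #0 #1 #2 [ p ∷ i ∷ v ∷ [] ])
      pairs p p∈ with to (∈-rep x̄) p∈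
      ... | i , eq = num (toℕ i) , embed (lookup x̄ i) , num-mono (Fin.toℕ<n i)
                   , from ⊨orderedPair eq
      values : ∀ i → i ∈ num n → ∃[ v ] v ∈ m × (∀ u →
               ((N ⊨ related #0 #1 #2 [ i ∷ rep x̄ ∷ u ∷ [] ]) → u ≡ v) ×
               (u ≡ v → N ⊨ related #0 #1 #2 [ i ∷ rep x̄ ∷ u ∷ [] ]))
      values i i∈n with to (∈-num n) i∈n
      ... | j , j<n , refl = subst
        (λ j → ∃[ v ] v ∈ m × (∀ u →
               ((N ⊨ related #0 #1 #2 [ num j ∷ rep x̄ ∷ u ∷ [] ]) → u ≡ v) ×
               (u ≡ v → N ⊨ related #0 #1 #2 [ num j ∷ rep x̄ ∷ u ∷ [] ])))
        (Fin.toℕ-fromℕ< j<n)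
        ( embed (lookup x̄ (fromℕ< j<n)) , embed∈ _
        , λ u → ⇔⇒× (⟨,⟩∈rep x̄ (fromℕ< j<n) ⇔-∘ ⊨related))

  -- This lets a formula of `N` say that a tuple extends the fixed parameters `ā`: it is inclusion
  -- of graphs, with `rep ā` as a parameter.
  rep-prefix : ∀ {k l} (ā : Vec U k) (x̄ : Vec U (k + l)) →
               (∀ p → p ∈ rep ā → p ∈ rep x̄) ⇔ (Σ[ b̄ ∈ Vec U l ] x̄ ≡ ā ++ b̄)
  rep-prefix {k} {l} ā x̄ = mk⇔ there back
    where
    index : (i : Fin k) → entry ā i ≡ ⟨ num (toℕ (i ↑ˡ l)) , embed (lookup ā i) ⟩
    index i = cong (λ j → ⟨ num j , embed (lookup ā i) ⟩) (sym (Fin.toℕ-↑ˡ i l))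
    there : (∀ p → p ∈ rep ā → p ∈ rep x̄) → Σ[ b̄ ∈ Vec U l ] x̄ ≡ ā ++ b̄
    there h with splitAt k x̄
    ... | ā′ , b̄ , refl = b̄ , cong (_++ b̄) (lookup-extensional ā′ ā λ i →
      trans (sym (lookup-++ˡ ā′ b̄ i)) (sym (injective
        (to (⟨,⟩∈rep (ā′ ++ b̄) (i ↑ˡ l))
          (subst (_∈ rep (ā′ ++ b̄)) (index i) (h _ (from (∈-rep ā) (i , refl))))))))
    back : (Σ[ b̄ ∈ Vec U l ] x̄ ≡ ā ++ b̄) → ∀ p → p ∈ rep ā → p ∈ rep x̄
    back (b̄ , refl) p p∈ with to (∈-rep ā) p∈
    ... | i , refl = subst (_∈ rep (ā ++ b̄)) (sym (index i))
      (from (⟨,⟩∈rep (ā ++ b̄) (i ↑ˡ l)) (cong embed (sym (lookup-++ˡ ā b̄ i))))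

  -- Realizing a computable type.

  module _ {k l : ℕ} (ā : Vec U k) (p : Pred (Formula (k + l)) 0ℓ)
           (f : Rec 1)
           (f-decides : ∀ c → ((∃[ φ ] p φ × code φ ≡ c) × f [ c ∷ [] ]⇓ 1) ⊎
                              (¬ (∃[ φ ] p φ × code φ ≡ c) × f [ c ∷ [] ]⇓ 0)) where

    -- The predicate `p` lives outside `N`; at standard codes `graph f` with value 1 stands in for
    -- it.
    f≡1 : ∀ c → (N ⊨ graph f [ num 1 ∷ num c ∷ [] ]) ⇔ (∃[ φ ] p φ × code φ ≡ c)
    f≡1 c with f-decides c
    ... | inj₁ (φ , f⇓) = mk⇔
      (λ _ → φ)
      λ _ → from (Represents.⊨graph (graph-represents f⇓) (num 1)) refl
    ... | inj₂ (¬φ , f⇓) = mk⇔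
      (λ h → ⊥-elim (∅≢S⁺ (sym (to (Represents.⊨graph (graph-represents f⇓) (num 1)) h))))
      (λ φ → ⊥-elim (¬φ φ))

    -- Deciding each code below `b` collects a finite list. One formula per code is enough, since a
    -- satisfaction class sees only codes.
    initialPart : ∀ b → Σ[ Δ ∈ List (Formula (k + l)) ] All p Δ ×
                  (∀ c → c < b → (∃[ φ ] p φ × code φ ≡ c) → ∃[ φ ] φ ∈ᴸ Δ × code φ ≡ c)
    initialPart zero = [] , [] , λ _ ()
    initialPart (suc b) with initialPart b | f-decides b
    ... | Δ , pΔ , h | inj₁ ((φ , pφ , refl) , _) = φ ∷ Δ , pφ ∷ pΔ , h′
      where
      h′ : ∀ c → c < suc b → (∃[ φ ] p φ × code φ ≡ c) → ∃[ ψ ] ψ ∈ᴸ φ ∷ Δ × code ψ ≡ c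
      h′ c c<sb q with ℕ.m<1+n⇒m<n∨m≡n c<sb
      ... | inj₁ c<b  = let ψ , ψ∈Δ , eq = h c c<b q in ψ , Any.there ψ∈Δ , eq
      ... | inj₂ refl = φ , Any.here refl , refl
    ... | Δ , pΔ , h | inj₂ (¬φ , _) = Δ , pΔ , λ c c<sb q →
      [ (λ c<b → h c c<b q) , (λ { refl → ⊥-elim (¬φ q) }) ]′ (ℕ.m<1+n⇒m<n∨m≡n c<sb)

    -- Variables d, A, m, E, ā, k + l, 1.
    realizedBelow : Formula 7
    realizedBelow = ∃′ ∃′
      (  rename (#1 ◂ #2 ◂ #3 ◂ #4 ◂ #5 ◂ λ ()) satisfactionClass
      ∧′ sequence #0 #7 #4
      ∧′ ∀′ (#0 ∈′ #7 ⇒′ #0 ∈′ #1)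
      ∧′ ∀′ (#0 ∈′ #3 ⇒′ rename (suc #8 ◂ #0 ◂ λ ()) (graph f) ⇒′ related #0 #2 #1))

    parameters : Vec V 6
    parameters = assignments ∷ m ∷ E ∷ rep ā ∷ num (k + l) ∷ num 1 ∷ []

    RealizedBelow : V → Set ℓ
    RealizedBelow d = ∃[ S ] Σ[ x̄ ∈ Vec U l ] SatisfactionClass S d ×
      (∀ c → c ∈ d → N ⊨ graph f [ num 1 ∷ c ∷ [] ] → ⟨ c , rep (ā ++ x̄) ⟩ ∈ S)

    ⊨realizedBelow : ∀ {d} → (N ⊨ realizedBelow [ d ∷ parameters ]) ⇔ RealizedBelow d
    ⊨realizedBelow {d} = mk⇔ there back
      where
      class : ∀ S e → (N ⊨ rename (#1 ◂ #2 ◂ #3 ◂ #4 ◂ #5 ◂ λ ()) satisfactionClass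
                         [ e ∷ S ∷ d ∷ parameters ]) ⇔ SatisfactionClass S d
      class S e = ⊨satisfactionClass ⇔-∘ ⊨-rename _ satisfactionClass
        λ { #0 → refl ; #1 → refl ; #2 → refl ; #3 → refl ; #4 → refl }
      renamed : ∀ S e c → (N ⊨ rename (suc #8 ◂ #0 ◂ λ ()) (graph f)
                             [ c ∷ e ∷ S ∷ d ∷ parameters ]) ⇔
                          (N ⊨ graph f [ num 1 ∷ c ∷ [] ])
      renamed S e c = ⊨-rename _ (graph f) λ { #0 → refl ; #1 → refl }
      there : N ⊨ realizedBelow [ d ∷ parameters ] → RealizedBelow d
      there (S , e , S-class , e-seq , prefix , h) with to (⊨sequence {e} {k + l}) e-seq
      ... | ȳ , refl with to (rep-prefix ā ȳ) prefix
      ... | x̄ , refl = S , x̄ , (λ {c} {e} → to (class S _) S-class {c} {e})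
                     , λ c c∈d q → to ⊨related (h c c∈d (from (renamed S _ c) q))
      back : RealizedBelow d → N ⊨ realizedBelow [ d ∷ parameters ]
      back (S , x̄ , S-class , h) =
          S , rep (ā ++ x̄) , from (class S _) (λ {c} {e} → S-class {c} {e})
        , from (⊨sequence {rep (ā ++ x̄)} {k + l}) (ā ++ x̄ , refl)
        , from (rep-prefix ā (ā ++ x̄)) (x̄ , refl)
        , λ c c∈d q → from ⊨related (h c c∈d (to (renamed S _ c) q))

    realizedBelow-standard : FinitelyRealizable M p ā → ∀ b → RealizedBelow (num b)
    realizedBelow-standard finitely b
      with recursion tarski (m ∷ E ∷ []) assignments b | initialPart b
    ... | S , S-class | Δ , pΔ , complete with finitely Δ pΔ
    ... | x̄ , Δ-true = S , x̄ , (λ {c} {e} → S-class {c} {e}) , true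
      where
      true : ∀ c → c ∈ num b → N ⊨ graph f [ num 1 ∷ c ∷ [] ] → ⟨ c , rep (ā ++ x̄) ⟩ ∈ S
      true c c∈b q with to (∈-num b) c∈b
      ... | i , i<b , refl with complete i i<b (to (f≡1 i) q)
      ... | φ , φ∈Δ , refl = from
        (satisfies (λ {c} {e} → S-class {c} {e}) φ
          (λ j j≤i → num-mono (ℕ.≤-<-trans j≤i i<b)) (ā ++ x̄))
        (All.lookup Δ-true φ∈Δ)

    realized : ∀ {d} → (∀ i → num i ∈ d) → RealizedBelow d → Realized M p ā
    realized num∈d (S , x̄ , S-class , h) = x̄ , λ φ pφ →
      to (satisfies (λ {c} {e} → S-class {c} {e}) φ (λ i _ → num∈d i) (ā ++ x̄))
         (h _ (num∈d (code φ)) (from (f≡1 (code φ)) (φ , pφ , refl)))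

  computablySaturated : ∀ {w c} → IsOmega w → c ∈ w → Nonstandard c → ComputablySaturated M
  computablySaturated isω c∈w nonstd ā p (f , f-decides) finitely
    with overspill isω c∈w nonstd (realizedBelow ā p f f-decides) (parameters ā p f f-decides)
           (λ b → from (⊨realizedBelow ā p f f-decides)
                       (realizedBelow-standard ā p f f-decides finitely b))
  ... | d , num∈d , h =
    realized ā p f f-decides num∈d (to (⊨realizedBelow ā p f f-decides) h)

  -- From an ill-founded ω to a nonstandard number.

  -- Any element of the set `s` without minimal element will do. The inner structure `M` here is the
  -- one in which overspill is later carried out.
  nonstandardNumber : (zfcᴹ : M ⊨ZFC) → N ⊨ illFoundedOmega #0 #1 [ m ∷ E ∷ [] ] →
                      ∃[ w ] ∃[ c ] SetTheory.IsOmega M zfcᴹ w × c ∈ᴹ w ×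
                                    SetTheory.Nonstandard M zfcᴹ c
  nonstandardNumber zfcᴹ (w , w∈m , isω , s , (c , c∈s) , s⊆w , noMinimum)
    with to (range w) w∈m | s⊆w c c∈s
  ... | w₀ , refl | c∈m , c∈w with to (range c) c∈m
  ... | c₀ , refl = w₀ , c₀
    , to (⊨-relativize (λ _ → #0) (omega {1} #0) {#1} {#2} {embed w₀ ∷ m ∷ E ∷ []} {w₀ ∷ []}
            refl refl λ { #0 → refl }) isω
    , to ∈-embed (to ⊨related c∈w)
    , λ { i refl → standard∉s (suc i) i ℕ.≤-refl c∈s }
    where
    module ST = SetTheory M zfcᴹ
    -- An element of `s` below a numeral is a smaller numeral in `s`; the bound `b` makes this
    -- descent a structural recursion.
    standard∉s : ∀ b i → i < b → ¬ (embed (ST.num i) ∈ s)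
    standard∉s (suc b) i (s≤s i≤b) i∈s with noMinimum _ i∈s
    ... | y , y∈s , y∈i with to (range y) (proj₁ (s⊆w y y∈s))
    ... | y₀ , refl with to (ST.∈-num i) (to ∈-embed (to ⊨related y∈i))
    ... | j , j<i , refl = standard∉s b j (ℕ.<-≤-trans j<i i≤b) y∈s

mainTheorem2 : {ℓ ℓ′ : Level} (𝓜 : Multiverse ℓ ℓ′) → WellfoundednessMirage 𝓜 →
    (M : Structure ℓ) → Multiverse.Member 𝓜 M → M ⊨ZFC × ComputablySaturated M
mainTheorem2 𝓜 mirage M M∈𝓜
  with mirage M M∈𝓜
... | N , N∈𝓜 , m , E , M-in-N , _
  -- The axiom is now applied to the model that contains `M`, to give that model a nonstandard
  -- number.
  with mirage N N∈𝓜
... | N′ , N′∈𝓜 , m′ , E′ , N-in-N′ , illFounded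
  with SetModel.nonstandardNumber N N′ (models 𝓜 N′∈𝓜) N-in-N′ (models 𝓜 N∈𝓜) illFounded
... | w , c , isω , c∈w , nonstd =
  models 𝓜 M∈𝓜 , SetModel.computablySaturated M N (models 𝓜 N∈𝓜) M-in-N isω c∈w nonstd
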